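{- Let $b\ge2$ be an integer and let $w$ be a fixed block of $b$-ary digits of length $p\ge1$. Let $s$ be any string of $b$-ary digits of length $\ell\ge0$. Let $$k_w^*(s)=\max_{|z|=p-1}k_w(sz),$$ where the maximum is over all strings $z$ of length $p-1$. Then for every integer $k\ge 1+k_w^*(s)$, $$\sum_{X:\;k_w(X)=k,\ X\text{ has prefix }s} b^{ -|X|}=b^{p}\,b^{ -\ell}.$$ In particular, for every $k\ge1$, $$Z_w(k)(b^{ -1})=\sum_{X:\,k_w(X)=k}b^{ -|X|}=b^p.$$
   Context: Strings are finite sequences over $\{0,\dots,b-1\}$, including the empty string $\epsilon$. $|X|$ is the length of $X$, and $sz$ is concatenation. $k_w(X)$ is the number of possibly overlapping occurrences of $w$ in $X$: indices $i$ with $x_i\dots x_{i+p-1}=w$. A string $X$ is $k$-admissible if $k_w(X)=k$. $N_w(k,l)$ is the number of $k$-admissible strings of length $l$, and $Z_w(k)=\sum_{l\ge0}N_w(k,l)t^l$. -}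

module Defs where

open import Algebra.Definitions.RawSemiring using () renaming (_^_ to pow)
open import Data.Fin.Base using (Fin)
import Data.Fin.Properties as Fin
open import Data.Integer.Base using (+_; 1ℤ)
open import Data.List.Base
  using (List; []; _∷_; _++_; length; map; filter; foldr; take; drop; upTo; allFin; cartesianProductWith)
open import Data.List.Extrema.Nat using (max)
import Data.List.Properties as List
open import Data.List.Relation.Binary.Prefix.Heterogeneous using (Prefix)
open import Data.List.Relation.Binary.Subset.Propositional using (_⊆_)
open import Data.List.Relation.Unary.All using (All)
open import Data.List.Relation.Unary.Unique.Propositional using (Unique)
open import Data.Nat.Base as ℕ using (ℕ; zero; suc; _∸_; NonTrivial; nonTrivial⇒nonZero)
import Data.Nat.Properties as ℕ
open import Data.Product.Base using (∃-syntax; _×_)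
open import Data.Rational.Base
  using (ℚ; 0ℚ; _+_; _-_; _*_; _<_; _/_; ∣_∣; +-*-rawSemiring)
open import Relation.Binary.Definitions using (DecidableEquality)
open import Relation.Binary.PropositionalEquality.Core using (_≡_)

infixr 8 _^_
_^_ : ℚ → ℕ → ℚ
_^_ = pow +-*-rawSemiring

fromℕ : ℕ → ℚ
fromℕ n = + n / 1

inv : (b : ℕ) .{{_ : NonTrivial b}} → ℚ
inv b = _/_ 1ℤ b {{nonTrivial⇒nonZero b}}

Word : ℕ → Set
Word b = List (Fin b)

_≟ʷ_ : ∀ {b} → DecidableEquality (Word b)
_≟ʷ_ = List.≡-dec Fin._≟_

words : ∀ b → ℕ → List (Word b)
words b zero    = [] ∷ []
words b (suc n) = cartesianProductWith _∷_ (allFin b) (words b n)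

HasPrefix : ∀ {b} → Word b → Word b → Set
HasPrefix s X = Prefix _≡_ s X

-- Indices start at 0.  Near the end of X, `take` returns fewer than
-- `length w` digits, so no occurrence is counted there.  For nonempty w,
-- the indices below `length X` are all the possible starting positions.
occurrences : ∀ {b} → Word b → Word b → ℕ
occurrences w X =
  length (filter (λ i → take (length w) (drop i X) ≟ʷ w) (upTo (length X)))

Admissible : ∀ {b} → Word b → ℕ → Word b → Set
Admissible w k X = occurrences w X ≡ k

-- The default value 0 of `max` is harmless: it is a lower bound for all
-- the occurrence counts.
k* : ∀ {b} → Word b → Word b → ℕ
k* {b} w s = max 0 (map (λ z → occurrences w (s ++ z)) (words b (length w ∸ 1)))

N : ∀ {b} → Word b → ℕ → ℕ → ℕ
N {b} w k l = length (filter (λ X → occurrences w X ℕ.≟ k) (words b l))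

PowerSeries : Set
PowerSeries = ℕ → ℕ

Z : ∀ {b} → Word b → ℕ → PowerSeries
Z w k l = N w k l

∑ : ∀ {A : Set} → List A → (A → ℚ) → ℚ
∑ xs f = foldr _+_ 0ℚ (map f xs)

_ConvergesTo_ : (ℕ → ℚ) → ℚ → Set
u ConvergesTo L =
  ∀ (ε : ℚ) → 0ℚ < ε → ∃[ n₀ ] (∀ n → n₀ ℕ.≤ n → ∣ u n - L ∣ < ε)

-- The power series converges at t, with value L.
_At_HasValue_ : PowerSeries → ℚ → ℚ → Set
a At t HasValue L = (λ n → ∑ (upTo n) (λ l → fromℕ (a l) * t ^ l)) ConvergesTo L

-- Unordered summation of f over {x | P x}: the sums over finite subsets
-- (duplicate-free lists) converge to L along the inclusion order.
SumOver : ∀ {A : Set} → (A → Set) → (A → ℚ) → ℚ → Set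
SumOver {A} P f L =
  ∀ (ε : ℚ) → 0ℚ < ε →
  ∃[ F₀ ] (Unique F₀ × All P F₀ ×
    (∀ (F : List A) → Unique F → All P F → F₀ ⊆ F → ∣ ∑ F f - L ∣ < ε))

{-# OPTIONS --safe #-}

-- Let p = |w|, and let z be a uniformly random word of length n.  Dropping the
-- first digit of a word changes its occurrence count exactly when the word starts
-- with w, so P(k_w ≤ k) at length n minus the same at length n + 1 is the
-- probability at length n + 1 that w is a prefix and k_w = k + 1.  Telescoping gives
--     b^p − ∑_{n<M} P(k_w(wz) = k + 1)  =  b^p · P(k_w ≤ k at length M + p − 1),
-- and the nonnegativity of the left side, used for all k at once, bounds
-- ∑_n P(k_w ≤ k), whose terms decrease, so the right side is O(1/M).
--
-- Call b^p − ∑_{n<M} P(k_w(sz) = K) the deficit of (s, K).  For k_w(s) < K it is the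
-- average of the deficits of the one-digit extensions of s.  When |s| ≥ p − 1, what
-- precedes s only shifts K, so deficits are nonnegative (after an occurrence of w the
-- telescoped formula applies) and the deficit of s is that of ws.  Reading s digit by
-- digit from w then bounds it by b^|s| times a deficit of w, hence it is O(1/M) too.
module Submission where

open import Defs
open import Data.Bool.Base using (if_then_else_)
open import Data.Fin.Base as Fin using (Fin)
import Data.Fin.Properties as Fin
open import Data.Integer.Base as ℤ using (1ℤ)
import Data.Integer.Properties as ℤ
open import Data.List.Base
open import Data.List.Extrema.Nat using (max; xs≤max)
open import Data.List.Membership.Propositional using (_∈_)
open import Data.List.Membership.Propositional.Properties
  using (∈-allFin; ∈-∃++; ∈-++⁻; ∈-++⁺ˡ; ∈-++⁺ʳ; ∈-map⁺; ∈-filter⁺; ∈-cartesianProductWith⁺)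
open import Data.List.Properties
open import Data.List.Relation.Binary.Prefix.Heterogeneous using ([]; _∷_)
open import Data.List.Relation.Binary.Subset.Propositional using (_⊆_)
open import Data.List.Relation.Unary.All as All using (All)
import Data.List.Relation.Unary.All.Properties as All
open import Data.List.Relation.Unary.AllPairs using ([]; _∷_)
open import Data.List.Relation.Unary.Any using (here; there)
open import Data.List.Relation.Unary.Unique.Propositional using (Unique)
import Data.List.Relation.Unary.Unique.Propositional.Properties as Unique
open import Data.Nat.Base as ℕ using (ℕ; zero; suc; NonTrivial; nonTrivial⇒nonZero; z≤n; s≤s)
import Data.Nat.Properties as ℕ
open import Data.Product.Base using (_×_; _,_; proj₁; proj₂; ∃-syntax)
open import Data.Rational.Base
  using (ℚ; 0ℚ; 1ℚ; _+_; _-_; _*_; -_; _≤_; _<_; *<*; ∣_∣; mkℚ; ↥_; ↧ₙ_; toℚᵘ; nonNegative)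
open import Data.Rational.Properties
open import Data.Rational.Solver using (module +-*-Solver)
import Data.Rational.Unnormalised.Base as ℚᵘ
import Data.Rational.Unnormalised.Properties as ℚᵘ
open import Data.Sum.Base using (inj₁; inj₂)
open import Function.Base using (_∘_; id)
open import Relation.Binary.PropositionalEquality
open import Relation.Nullary.Decidable.Core using (Dec; does; yes; no)
open import Relation.Nullary.Negation.Core using (¬_; contradiction)
open import Relation.Unary using (Decidable)

private variable
  A B : Set

-- Embedding of the naturals, and order facts for rationals.

fromℕ-+ : ∀ m n → fromℕ (m ℕ.+ n) ≡ fromℕ m + fromℕ n
-- `fromℕ` normalises its fraction, so the equation is checked among unnormalised fractions, whose
-- numerators and denominators are explicit.
fromℕ-+ m n = toℚᵘ-injective (begin
  toℚᵘ (fromℕ (m ℕ.+ n))                    ≈⟨ toℚᵘ-fromℚᵘ (ℚᵘ.mkℚᵘ (ℤ.+ (m ℕ.+ n)) 0) ⟩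
  ℚᵘ.mkℚᵘ (ℤ.+ (m ℕ.+ n)) 0                 ≈⟨ ℚᵘ.*≡* (lem m n) ⟩
  ℚᵘ.mkℚᵘ (ℤ.+ m) 0 ℚᵘ.+ ℚᵘ.mkℚᵘ (ℤ.+ n) 0  ≈⟨ ℚᵘ.+-cong (toℚᵘ-fromℚᵘ (ℚᵘ.mkℚᵘ (ℤ.+ m) 0)) (toℚᵘ-fromℚᵘ (ℚᵘ.mkℚᵘ (ℤ.+ n) 0)) ⟨
  toℚᵘ (fromℕ m) ℚᵘ.+ toℚᵘ (fromℕ n)        ≈⟨ toℚᵘ-homo-+ (fromℕ m) (fromℕ n) ⟨
  toℚᵘ (fromℕ m + fromℕ n)                  ∎)
  where
  open ℚᵘ.≃-Reasoning
  lem : ∀ m n → ℤ.+ (m ℕ.+ n) ℤ.* (1ℤ ℤ.* 1ℤ) ≡ (ℤ.+ m ℤ.* 1ℤ ℤ.+ ℤ.+ n ℤ.* 1ℤ) ℤ.* 1ℤ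
  lem m n rewrite ℤ.*-identityʳ (ℤ.+ m) | ℤ.*-identityʳ (ℤ.+ n) = refl

fromℕ-suc : ∀ n → fromℕ (suc n) ≡ 1ℚ + fromℕ n
fromℕ-suc = fromℕ-+ 1

fromℕ*inv : ∀ b .{{_ : NonTrivial b}} → fromℕ b * inv b ≡ 1ℚ
fromℕ*inv b@(suc b-1) = toℚᵘ-injective (begin
  toℚᵘ (fromℕ b * inv b)                 ≈⟨ toℚᵘ-homo-* (fromℕ b) (inv b) ⟩
  toℚᵘ (fromℕ b) ℚᵘ.* toℚᵘ (inv b)       ≈⟨ ℚᵘ.*-cong (toℚᵘ-fromℚᵘ (ℚᵘ.mkℚᵘ (ℤ.+ b) 0)) (toℚᵘ-fromℚᵘ (ℚᵘ.mkℚᵘ 1ℤ b-1)) ⟩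
  ℚᵘ.mkℚᵘ (ℤ.+ b) 0 ℚᵘ.* ℚᵘ.mkℚᵘ 1ℤ b-1  ≈⟨ ℚᵘ.*≡* (trans (ℤ.*-identityʳ _) (trans (ℤ.*-identityʳ _) (sym (trans (ℤ.*-identityˡ _) (cong ℤ.+_ (ℕ.*-identityˡ b)))))) ⟩
  ℚᵘ.mkℚᵘ 1ℤ 0                           ∎)
  where open ℚᵘ.≃-Reasoning

0≤fromℕ : ∀ n → 0ℚ ≤ fromℕ n
0≤fromℕ n = nonNegative⁻¹ _ {{normalize-nonNeg n 1}}

0≤inv : ∀ b .{{_ : NonTrivial b}} → 0ℚ ≤ inv b
0≤inv b = nonNegative⁻¹ _ {{normalize-nonNeg 1 b {{nonTrivial⇒nonZero b}}}}

*-monoˡ : ∀ {c x y} → 0ℚ ≤ c → x ≤ y → c * x ≤ c * y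
*-monoˡ {c} 0≤c = *-monoˡ-≤-nonNeg c {{nonNegative 0≤c}}

*-monoʳ : ∀ {c x y} → 0ℚ ≤ c → x ≤ y → x * c ≤ y * c
*-monoʳ {c} 0≤c = *-monoʳ-≤-nonNeg c {{nonNegative 0≤c}}

0≤* : ∀ {x y} → 0ℚ ≤ x → 0ℚ ≤ y → 0ℚ ≤ x * y
0≤* {x} {y} 0≤x 0≤y = subst (_≤ x * y) (*-zeroʳ x) (*-monoˡ 0≤x 0≤y)

0≤^ : ∀ {x} → 0ℚ ≤ x → ∀ n → 0ℚ ≤ x ^ n
0≤^ 0≤x zero    = 0≤fromℕ 1
0≤^ 0≤x (suc n) = 0≤* 0≤x (0≤^ 0≤x n)

fromℕ-mono : ∀ {m n} → m ℕ.≤ n → fromℕ m ≤ fromℕ n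
fromℕ-mono {m} {n} m≤n = subst₂ _≤_ (+-identityʳ _) (trans (sym (fromℕ-+ m (n ℕ.∸ m))) (cong fromℕ (ℕ.m+[n∸m]≡n m≤n)))
  (+-monoʳ-≤ (fromℕ m) (0≤fromℕ (n ℕ.∸ m)))

-- Indicators of decidable propositions.

𝟙 : ∀ {P : Set} → Dec P → ℚ
𝟙 P? = if does P? then 1ℚ else 0ℚ

module _ {P : Set} where

  0≤𝟙 : (P? : Dec P) → 0ℚ ≤ 𝟙 P?
  0≤𝟙 (yes _) = 0≤fromℕ 1
  0≤𝟙 (no _)  = ≤-refl

  𝟙-yes : (P? : Dec P) → P → 𝟙 P? ≡ 1ℚ
  𝟙-yes (yes _) p = refl
  𝟙-yes (no ¬p) p = contradiction p ¬p

  𝟙-no : (P? : Dec P) → ¬ P → 𝟙 P? ≡ 0ℚ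
  𝟙-no (yes p) ¬p = contradiction p ¬p
  𝟙-no (no _)  ¬p = refl

𝟙-mono : ∀ {P Q : Set} (P? : Dec P) (Q? : Dec Q) → (P → Q) → 𝟙 P? ≤ 𝟙 Q?
𝟙-mono (yes p) Q? f = ≤-reflexive (sym (𝟙-yes Q? (f p)))
𝟙-mono (no _)  Q? f = 0≤𝟙 Q?

𝟙-⇔ : ∀ {P Q : Set} (P? : Dec P) (Q? : Dec Q) → (P → Q) → (Q → P) → 𝟙 P? ≡ 𝟙 Q?
𝟙-⇔ P? Q? f g = ≤-antisym (𝟙-mono P? Q? f) (𝟙-mono Q? P? g)

-- Finite sums.

+-interchange : ∀ u v x y → (u + v) + (x + y) ≡ (u + x) + (v + y)
+-interchange = solve 4 (λ u v x y → (u :+ v) :+ (x :+ y) := (u :+ x) :+ (v :+ y)) refl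
  where open +-*-Solver

*-swapˡ : ∀ x y z → x * (y * z) ≡ y * (x * z)
*-swapˡ = solve 3 (λ x y z → x :* (y :* z) := y :* (x :* z)) refl
  where open +-*-Solver

∑-cong : ∀ (xs : List A) {f g : A → ℚ} → (∀ x → f x ≡ g x) → ∑ xs f ≡ ∑ xs g
∑-cong xs f≗g = cong (foldr _+_ 0ℚ) (map-cong f≗g xs)

∑-+ : ∀ (xs : List A) (f g : A → ℚ) → ∑ xs (λ x → f x + g x) ≡ ∑ xs f + ∑ xs g
∑-+ []       f g = refl
∑-+ (x ∷ xs) f g = trans (cong (f x + g x +_) (∑-+ xs f g)) (+-interchange (f x) (g x) (∑ xs f) (∑ xs g))

∑-* : ∀ (xs : List A) c (f : A → ℚ) → ∑ xs (λ x → c * f x) ≡ c * ∑ xs f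
∑-* []       c f = sym (*-zeroʳ c)
∑-* (x ∷ xs) c f = trans (cong (c * f x +_) (∑-* xs c f)) (sym (*-distribˡ-+ c (f x) (∑ xs f)))

∑-const : ∀ (xs : List A) c → ∑ xs (λ _ → c) ≡ fromℕ (length xs) * c
∑-const []       c = sym (*-zeroˡ c)
∑-const (x ∷ xs) c = begin
  c + ∑ xs (λ _ → c)              ≡⟨ cong₂ _+_ (sym (*-identityˡ c)) (∑-const xs c) ⟩
  1ℚ * c + fromℕ (length xs) * c  ≡⟨ *-distribʳ-+ c 1ℚ (fromℕ (length xs)) ⟨
  (1ℚ + fromℕ (length xs)) * c    ≡⟨ cong (_* c) (fromℕ-suc (length xs)) ⟨
  fromℕ (suc (length xs)) * c     ∎
  where open ≡-Reasoning

∑-mono : ∀ (xs : List A) {f g : A → ℚ} → (∀ x → f x ≤ g x) → ∑ xs f ≤ ∑ xs g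
∑-mono []       f≤g = ≤-refl
∑-mono (x ∷ xs) f≤g = +-mono-≤ (f≤g x) (∑-mono xs f≤g)

∑-0 : ∀ (xs : List A) → ∑ xs (λ _ → 0ℚ) ≡ 0ℚ
∑-0 xs = trans (∑-const xs 0ℚ) (*-zeroʳ (fromℕ (length xs)))

∑-nonNeg : ∀ (xs : List A) {f : A → ℚ} → (∀ x → 0ℚ ≤ f x) → 0ℚ ≤ ∑ xs f
∑-nonNeg xs {f} 0≤f = subst (_≤ ∑ xs f) (∑-0 xs) (∑-mono xs 0≤f)

∑-++ : ∀ (xs ys : List A) (f : A → ℚ) → ∑ (xs ++ ys) f ≡ ∑ xs f + ∑ ys f
∑-++ []       ys f = sym (+-identityˡ _)
∑-++ (x ∷ xs) ys f = trans (cong (f x +_) (∑-++ xs ys f)) (sym (+-assoc (f x) _ _))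

∑-map : ∀ (h : A → B) (xs : List A) (f : B → ℚ) → ∑ (map h xs) f ≡ ∑ xs (f ∘ h)
∑-map h xs f = cong (foldr _+_ 0ℚ) (sym (map-∘ xs))

∑-swap : ∀ (xs : List A) (ys : List B) (f : A → B → ℚ) →
         ∑ xs (λ x → ∑ ys (f x)) ≡ ∑ ys (λ y → ∑ xs (λ x → f x y))
∑-swap []       ys f = sym (∑-0 ys)
∑-swap (x ∷ xs) ys f = trans (cong (∑ ys (f x) +_) (∑-swap xs ys f)) (sym (∑-+ ys (f x) _))

∑-cartesianProductWith : ∀ {C : Set} (h : A → B → C) (xs : List A) (ys : List B) (f : C → ℚ) →
  ∑ (cartesianProductWith h xs ys) f ≡ ∑ xs (λ x → ∑ ys (λ y → f (h x y)))
∑-cartesianProductWith h []       ys f = refl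
∑-cartesianProductWith h (x ∷ xs) ys f = trans (∑-++ (map (h x) ys) _ f)
  (cong₂ _+_ (∑-map (h x) ys f) (∑-cartesianProductWith h xs ys f))

∑-filter : ∀ {P : A → Set} (P? : Decidable P) (xs : List A) (f : A → ℚ) →
           ∑ (filter P? xs) f ≡ ∑ xs (λ x → 𝟙 (P? x) * f x)
∑-filter P? []       f = refl
∑-filter P? (x ∷ xs) f with P? x
... | yes _ = cong₂ _+_ (sym (*-identityˡ (f x))) (∑-filter P? xs f)
... | no _  = trans (∑-filter P? xs f) (trans (sym (+-identityˡ _)) (cong (_+ _) (sym (*-zeroˡ (f x)))))

∑-∈ : ∀ {xs : List A} {f : A → ℚ} {x} → (∀ x → 0ℚ ≤ f x) → x ∈ xs → f x ≤ ∑ xs f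
∑-∈ {xs = x ∷ xs} {f} 0≤f (here refl) = subst (_≤ f x + ∑ xs f) (+-identityʳ (f x)) (+-monoʳ-≤ (f x) (∑-nonNeg xs 0≤f))
∑-∈ {xs = y ∷ xs} {f} {x} 0≤f (there i) = subst (_≤ f y + ∑ xs f) (+-identityˡ (f x)) (+-mono-≤ (0≤f y) (∑-∈ 0≤f i))

fromℕ-length-filter : ∀ {P : A → Set} (P? : Decidable P) (xs : List A) →
                      fromℕ (length (filter P? xs)) ≡ ∑ xs (λ x → 𝟙 (P? x))
fromℕ-length-filter P? xs = begin
  fromℕ (length (filter P? xs))       ≡⟨ *-identityʳ _ ⟨
  fromℕ (length (filter P? xs)) * 1ℚ  ≡⟨ ∑-const (filter P? xs) 1ℚ ⟨
  ∑ (filter P? xs) (λ _ → 1ℚ)         ≡⟨ ∑-filter P? xs (λ _ → 1ℚ) ⟩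
  ∑ xs (λ x → 𝟙 (P? x) * 1ℚ)          ≡⟨ ∑-cong xs (λ x → *-identityʳ (𝟙 (P? x))) ⟩
  ∑ xs (λ x → 𝟙 (P? x))               ∎
  where open ≡-Reasoning

∑-upTo-∷ : ∀ n (f : ℕ → ℚ) → ∑ (upTo (suc n)) f ≡ f 0 + ∑ (upTo n) (f ∘ suc)
∑-upTo-∷ n f = cong (f 0 +_) (trans (cong (λ xs → ∑ xs f) (sym (map-upTo suc n))) (∑-map suc (upTo n) f))

∑-upTo-∷ʳ : ∀ n (f : ℕ → ℚ) → ∑ (upTo (suc n)) f ≡ ∑ (upTo n) f + f n
∑-upTo-∷ʳ n f = begin
  ∑ (upTo (suc n)) f         ≡⟨ cong (λ xs → ∑ xs f) (upTo-∷ʳ n) ⟨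
  ∑ (upTo n ++ n ∷ []) f     ≡⟨ ∑-++ (upTo n) (n ∷ []) f ⟩
  ∑ (upTo n) f + (f n + 0ℚ)  ≡⟨ cong (∑ (upTo n) f +_) (+-identityʳ (f n)) ⟩
  ∑ (upTo n) f + f n         ∎
  where open ≡-Reasoning

∑-allFin-suc : ∀ n (f : Fin (suc n) → ℚ) → ∑ (allFin (suc n)) f ≡ f Fin.zero + ∑ (allFin n) (f ∘ Fin.suc)
∑-allFin-suc n f = cong (f Fin.zero +_) (trans (cong (λ xs → ∑ xs f) (sym (map-tabulate id Fin.suc))) (∑-map Fin.suc (allFin n) f))

∑-allFin-𝟙 : ∀ {n} (x : Fin n) (f : Fin n → ℚ) → ∑ (allFin n) (λ d → 𝟙 (d Fin.≟ x) * f d) ≡ f x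
∑-allFin-𝟙 {suc n} Fin.zero f = begin
  ∑ (allFin (suc n)) (λ d → 𝟙 (d Fin.≟ Fin.zero) * f d)      ≡⟨ ∑-allFin-suc n (λ d → 𝟙 (d Fin.≟ Fin.zero) * f d) ⟩
  1ℚ * f Fin.zero + ∑ (allFin n) (λ d → 0ℚ * f (Fin.suc d))  ≡⟨ cong₂ _+_ (*-identityˡ (f Fin.zero)) (∑-cong (allFin n) (λ d → *-zeroˡ (f (Fin.suc d)))) ⟩
  f Fin.zero + ∑ (allFin n) (λ _ → 0ℚ)                       ≡⟨ cong (f Fin.zero +_) (∑-0 (allFin n)) ⟩
  f Fin.zero + 0ℚ                                            ≡⟨ +-identityʳ (f Fin.zero) ⟩
  f Fin.zero                                                 ∎
  where open ≡-Reasoning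
∑-allFin-𝟙 {suc n} (Fin.suc x) f = begin
  ∑ (allFin (suc n)) (λ d → 𝟙 (d Fin.≟ Fin.suc x) * f d)                ≡⟨ ∑-allFin-suc n (λ d → 𝟙 (d Fin.≟ Fin.suc x) * f d) ⟩
  -- `𝟙` looks only at `does`, so the indicator of `Fin.suc d ≟ Fin.suc x` computes to that of
  -- `d ≟ x`.
  0ℚ * f Fin.zero + ∑ (allFin n) (λ d → 𝟙 (d Fin.≟ x) * f (Fin.suc d))  ≡⟨ cong₂ _+_ (*-zeroˡ (f Fin.zero)) (∑-allFin-𝟙 x (f ∘ Fin.suc)) ⟩
  0ℚ + f (Fin.suc x)                                                    ≡⟨ +-identityˡ (f (Fin.suc x)) ⟩
  f (Fin.suc x)                                                         ∎
  where open ≡-Reasoning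

-- Counting with filters, and indicator identities for counts.

length-filter-map : ∀ {P : B → Set} (P? : Decidable P) (f : A → B) (xs : List A) →
                    length (filter P? (map f xs)) ≡ length (filter (P? ∘ f) xs)
length-filter-map P? f []       = refl
length-filter-map P? f (x ∷ xs) with P? (f x)
... | yes _ = cong suc (length-filter-map P? f xs)
... | no _  = length-filter-map P? f xs

bit : ∀ {P : Set} → Dec P → ℕ
bit P? = if does P? then 1 else 0

bit-yes : ∀ {P : Set} (P? : Dec P) → P → bit P? ≡ 1
bit-yes (yes _) p = refl
bit-yes (no ¬p) p = contradiction p ¬p

bit-no : ∀ {P : Set} (P? : Dec P) → ¬ P → bit P? ≡ 0
bit-no (yes p) ¬p = contradiction p ¬p
bit-no (no _)  ¬p = refl

bit≤1 : ∀ {P : Set} (P? : Dec P) → bit P? ℕ.≤ 1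
bit≤1 (yes _) = s≤s z≤n
bit≤1 (no _)  = z≤n

length-filter-∷ : ∀ {P : A → Set} (P? : Decidable P) x (xs : List A) →
                  length (filter P? (x ∷ xs)) ≡ bit (P? x) ℕ.+ length (filter P? xs)
length-filter-∷ P? x xs with P? x
... | yes _ = refl
... | no _  = refl

take-++-≤ : ∀ n (xs ys : List A) → n ℕ.≤ length xs → take n (xs ++ ys) ≡ take n xs
take-++-≤ zero    xs       ys n≤   = refl
take-++-≤ (suc n) (x ∷ xs) ys (s≤s n≤) = cong (x ∷_) (take-++-≤ n xs ys n≤)

𝟙-≤-suc : ∀ n k → 𝟙 (n ℕ.≤? suc k) ≡ 𝟙 (n ℕ.≤? k) + 𝟙 (n ℕ.≟ suc k)
𝟙-≤-suc n k with n ℕ.≟ suc k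
... | yes refl = begin
  𝟙 (suc k ℕ.≤? suc k)                    ≡⟨ 𝟙-yes (suc k ℕ.≤? suc k) ℕ.≤-refl ⟩
  0ℚ + 1ℚ                                 ≡⟨ cong₂ _+_ (𝟙-no (suc k ℕ.≤? k) (ℕ.<-irrefl refl)) (𝟙-yes (suc k ℕ.≟ suc k) refl) ⟨
  𝟙 (suc k ℕ.≤? k) + 𝟙 (suc k ℕ.≟ suc k)  ∎
  where open ≡-Reasoning
... | no n≢ = begin
  𝟙 (n ℕ.≤? suc k)                ≡⟨ 𝟙-⇔ (n ℕ.≤? suc k) (n ℕ.≤? k) (λ n≤ → ℕ.s≤s⁻¹ (ℕ.≤∧≢⇒< n≤ n≢)) ℕ.m≤n⇒m≤1+n ⟩
  𝟙 (n ℕ.≤? k)                    ≡⟨ +-identityʳ (𝟙 (n ℕ.≤? k)) ⟨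
  𝟙 (n ℕ.≤? k) + 0ℚ               ≡⟨ cong (𝟙 (n ℕ.≤? k) +_) (𝟙-no (n ℕ.≟ suc k) n≢) ⟨
  𝟙 (n ℕ.≤? k) + 𝟙 (n ℕ.≟ suc k)  ∎
  where open ≡-Reasoning

-- The pointwise form of the telescoping: when a new first digit raises the count `n` by the bit, a
-- word leaves the event "count at most `k`" only if the bit is 1 and the new count is exactly
-- `suc k`.
𝟙-≤-bit : ∀ {P : Set} (P? : Dec P) n k →
  𝟙 (n ℕ.≤? k) ≡ 𝟙 (bit P? ℕ.+ n ℕ.≤? k) + 𝟙 P? * 𝟙 (bit P? ℕ.+ n ℕ.≟ suc k)
𝟙-≤-bit (yes _) n k = begin
  𝟙 (n ℕ.≤? k)                                 ≡⟨ 𝟙-⇔ (n ℕ.≤? k) (suc n ℕ.≤? suc k) s≤s ℕ.s≤s⁻¹ ⟩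
  𝟙 (suc n ℕ.≤? suc k)                         ≡⟨ 𝟙-≤-suc (suc n) k ⟩
  𝟙 (suc n ℕ.≤? k) + 𝟙 (suc n ℕ.≟ suc k)       ≡⟨ cong (𝟙 (suc n ℕ.≤? k) +_) (*-identityˡ (𝟙 (suc n ℕ.≟ suc k))) ⟨
  𝟙 (suc n ℕ.≤? k) + 1ℚ * 𝟙 (suc n ℕ.≟ suc k)  ∎
  where open ≡-Reasoning
𝟙-≤-bit (no _) n k = begin
  𝟙 (n ℕ.≤? k)                         ≡⟨ +-identityʳ (𝟙 (n ℕ.≤? k)) ⟨
  𝟙 (n ℕ.≤? k) + 0ℚ                    ≡⟨ cong (𝟙 (n ℕ.≤? k) +_) (*-zeroˡ (𝟙 (n ℕ.≟ suc k))) ⟨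
  𝟙 (n ℕ.≤? k) + 0ℚ * 𝟙 (n ℕ.≟ suc k)  ∎
  where open ≡-Reasoning

𝟙-∷ : ∀ {b} (x y : Fin b) (xs ys : Word b) → 𝟙 ((x ∷ xs) ≟ʷ (y ∷ ys)) ≡ 𝟙 (x Fin.≟ y) * 𝟙 (xs ≟ʷ ys)
𝟙-∷ x y xs ys with x Fin.≟ y | xs ≟ʷ ys
... | yes _ | yes _ = refl
... | yes _ | no _  = refl
... | no _  | yes _ = refl
... | no _  | no _  = refl

-- Powers, and the Archimedean property of the rationals.

0≤- : ∀ {x y} → x ≤ y → 0ℚ ≤ y - x
0≤- {x} {y} x≤y = subst (_≤ y - x) (+-inverseʳ x) (+-monoˡ-≤ (- x) x≤y)

x-y≤x : ∀ {x y} → 0ℚ ≤ y → x - y ≤ x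
x-y≤x {x} {y} 0≤y = subst (x - y ≤_) (+-identityʳ x) (+-monoʳ-≤ x (neg-antimono-≤ 0≤y))

x+y-y≡x : ∀ x y → (x + y) - y ≡ x
x+y-y≡x = solve 2 (λ x y → (x :+ y) :- y := x) refl
  where open +-*-Solver

^-inverse : ∀ {x y} → x * y ≡ 1ℚ → ∀ n → x ^ n * y ^ n ≡ 1ℚ
^-inverse xy≡1 zero = refl
^-inverse {x} {y} xy≡1 (suc n) = begin
  x * x ^ n * (y * y ^ n)  ≡⟨ solve 4 (λ x a y b → x :* a :* (y :* b) := x :* y :* (a :* b)) refl x (x ^ n) y (y ^ n) ⟩
  x * y * (x ^ n * y ^ n)  ≡⟨ cong₂ _*_ xy≡1 (^-inverse {x} {y} xy≡1 n) ⟩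
  1ℚ * 1ℚ                  ≡⟨⟩
  1ℚ                       ∎
  where
  open ≡-Reasoning
  open +-*-Solver

^-+ : ∀ x m n → x ^ (m ℕ.+ n) ≡ x ^ m * x ^ n
^-+ x zero    n = sym (*-identityˡ (x ^ n))
^-+ x (suc m) n = trans (cong (x *_) (^-+ x m n)) (sym (*-assoc x (x ^ m) (x ^ n)))

-- A denominator is at least 1, so dividing by it does not increase the absolute value of the
-- numerator.
≤fromℕ∣↥∣ : ∀ x → x ≤ fromℕ ℤ.∣ ↥ x ∣
≤fromℕ∣↥∣ x@(mkℚ n d-1 _) = toℚᵘ-cancel-≤ (ℚᵘ.≤-respʳ-≃ (ℚᵘ.≃-sym (toℚᵘ-fromℚᵘ (ℚᵘ.mkℚᵘ (ℤ.+ ℤ.∣ n ∣) 0)))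
  (ℚᵘ.*≤* (begin
    n ℤ.* 1ℤ                     ≡⟨ ℤ.*-identityʳ n ⟩
    n                            ≤⟨ lem n ⟩
    ℤ.+ ℤ.∣ n ∣                  ≤⟨ ℤ.+≤+ (ℕ.m≤m*n ℤ.∣ n ∣ (suc d-1)) ⟩
    ℤ.+ (ℤ.∣ n ∣ ℕ.* suc d-1)    ≡⟨ ℤ.pos-* ℤ.∣ n ∣ (suc d-1) ⟩
    ℤ.+ ℤ.∣ n ∣ ℤ.* ℤ.+ suc d-1  ∎)))
  where
  open ℤ.≤-Reasoning
  lem : ∀ n → n ℤ.≤ ℤ.+ ℤ.∣ n ∣
  lem (ℤ.+ n)    = ℤ.≤-refl
  lem ℤ.-[1+ n ] = ℤ.-≤+

-- The product is the numerator of `ε`, a positive integer.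
1≤↧*ε : ∀ {ε} → 0ℚ < ε → 1ℚ ≤ fromℕ (↧ₙ ε) * ε
1≤↧*ε {ε@(mkℚ (ℤ.+ suc a) d-1 _)} _ = toℚᵘ-cancel-≤ (ℚᵘ.≤-respʳ-≃ (ℚᵘ.≃-sym
  (ℚᵘ.≃-trans (toℚᵘ-homo-* (fromℕ (suc d-1)) ε) (ℚᵘ.*-cong (toℚᵘ-fromℚᵘ (ℚᵘ.mkℚᵘ (ℤ.+ suc d-1) 0)) (ℚᵘ.≃-refl {toℚᵘ ε}))))
  (ℚᵘ.*≤* (begin
    1ℤ ℤ.* ℤ.+ (1 ℕ.* suc d-1)        ≡⟨ ℤ.*-identityˡ (ℤ.+ (1 ℕ.* suc d-1)) ⟩
    ℤ.+ (1 ℕ.* suc d-1)               ≡⟨ cong ℤ.+_ (ℕ.*-identityˡ (suc d-1)) ⟩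
    ℤ.+ suc d-1                       ≤⟨ ℤ.+≤+ (ℕ.m≤m*n (suc d-1) (suc a)) ⟩
    ℤ.+ (suc d-1 ℕ.* suc a)           ≡⟨ ℤ.pos-* (suc d-1) (suc a) ⟩
    ℤ.+ suc d-1 ℤ.* ℤ.+ suc a         ≡⟨ ℤ.*-identityʳ (ℤ.+ suc d-1 ℤ.* ℤ.+ suc a) ⟨
    ℤ.+ suc d-1 ℤ.* ℤ.+ suc a ℤ.* 1ℤ  ∎)))
  where open ℤ.≤-Reasoning
1≤↧*ε {mkℚ (ℤ.+ 0) _ _} (*<* (ℤ.+<+ ()))
1≤↧*ε {mkℚ ℤ.-[1+ _ ] _ _} (*<* ())

archimedean : ∀ C {ε} → 0ℚ < ε → ∃[ n ] C < fromℕ n * ε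
archimedean C {ε} 0<ε = n , (begin-strict
  C                              ≤⟨ ≤fromℕ∣↥∣ C ⟩
  fromℕ m                        ≡⟨ +-identityˡ (fromℕ m) ⟨
  0ℚ + fromℕ m                   <⟨ +-monoˡ-< (fromℕ m) {0ℚ} {1ℚ} (*<* (ℤ.+<+ (s≤s z≤n))) ⟩
  1ℚ + fromℕ m                   ≡⟨ fromℕ-suc m ⟨
  fromℕ (suc m)                  ≡⟨ *-identityʳ (fromℕ (suc m)) ⟨
  fromℕ (suc m) * 1ℚ             ≤⟨ *-monoˡ (0≤fromℕ (suc m)) (1≤↧*ε 0<ε) ⟩
  fromℕ (suc m) * (fromℕ d * ε)  ≡⟨ *-assoc (fromℕ (suc m)) (fromℕ d) ε ⟨
  fromℕ (suc m) * fromℕ d * ε    ≡⟨ cong (_* ε) (fromℕ-* (suc m) d) ⟨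
  fromℕ n * ε                    ∎)
  where
  open ≤-Reasoning
  m = ℤ.∣ ↥ C ∣
  d = ↧ₙ ε
  -- The factor `d` makes `fromℕ d * ε` at least 1. The successor of `m` makes the final inequality
  -- strict.
  n = suc m ℕ.* d
  fromℕ-* : ∀ m n → fromℕ (m ℕ.* n) ≡ fromℕ m * fromℕ n
  fromℕ-* zero    n = sym (*-zeroˡ (fromℕ n))
  fromℕ-* (suc m) n = trans (fromℕ-+ n (m ℕ.* n)) (trans (cong₂ _+_ (sym (*-identityˡ (fromℕ n))) (fromℕ-* m n))
    (trans (sym (*-distribʳ-+ (fromℕ n) 1ℚ (fromℕ m))) (cong (_* fromℕ n) (sym (fromℕ-suc m)))))

-- For `n₀` with `C < n₀ ε`, every `n ≥ n₀` has `n u(n) ≤ C < n₀ ε ≤ n ε`, and `n` cancels.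
O[1/n]⇒small : ∀ {u : ℕ → ℚ} {C} → (∀ n → fromℕ n * u n ≤ C) →
                 ∀ ε → 0ℚ < ε → ∃[ n₀ ] (∀ n → n₀ ℕ.≤ n → u n < ε)
O[1/n]⇒small {u} {C} nu≤C ε 0<ε = n₀ , λ n n₀≤n →
  *-cancelˡ-<-nonNeg (fromℕ n) {{nonNegative (0≤fromℕ n)}} {u n} {ε} (begin-strict
    fromℕ n * u n  ≤⟨ nu≤C n ⟩
    C              <⟨ proj₂ (archimedean C 0<ε) ⟩
    fromℕ n₀ * ε   ≤⟨ *-monoʳ {ε} {fromℕ n₀} {fromℕ n} (<⇒≤ 0<ε) (fromℕ-mono n₀≤n) ⟩
    fromℕ n * ε    ∎)
  where
  open ≤-Reasoning
  n₀ = proj₁ (archimedean C 0<ε)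

-- Absolute values, sums over subsets, and prefixes.

∣x-y∣≡y-x : ∀ x y → 0ℚ ≤ y - x → ∣ x - y ∣ ≡ y - x
∣x-y∣≡y-x x y 0≤y-x = trans (cong ∣_∣ (solve 2 (λ x y → x :- y := :- (y :- x)) refl x y))
  (trans (∣-p∣≡∣p∣ (y - x)) (0≤p⇒∣p∣≡p 0≤y-x))
  where open +-*-Solver

-- Each element of `xs` is cut out of `ys` in turn. By uniqueness the later elements differ from it,
-- so they survive the cut; whatever is left of `ys` contributes a nonnegative amount.
∑-⊆ : ∀ {xs ys : List A} {f : A → ℚ} → Unique xs → xs ⊆ ys → (∀ x → 0ℚ ≤ f x) → ∑ xs f ≤ ∑ ys f
∑-⊆ {xs = []} {ys} [] xs⊆ys 0≤f = ∑-nonNeg ys 0≤f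
∑-⊆ {xs = x ∷ xs} {f = f} (x∉ ∷ xs!) xs⊆ys 0≤f with as , bs , refl ← ∈-∃++ (xs⊆ys (here refl)) = begin
  f x + ∑ xs f             ≤⟨ +-monoʳ-≤ (f x) (∑-⊆ xs! xs⊆as++bs 0≤f) ⟩
  f x + ∑ (as ++ bs) f     ≡⟨ cong (f x +_) (∑-++ as bs f) ⟩
  f x + (∑ as f + ∑ bs f)  ≡⟨ solve 3 (λ x a b → x :+ (a :+ b) := a :+ (x :+ b)) refl (f x) (∑ as f) (∑ bs f) ⟩
  ∑ as f + ∑ (x ∷ bs) f    ≡⟨ ∑-++ as (x ∷ bs) f ⟨
  ∑ (as ++ x ∷ bs) f       ∎
  where
  open ≤-Reasoning
  open +-*-Solver
  xs⊆as++bs : xs ⊆ as ++ bs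
  xs⊆as++bs y∈xs with ∈-++⁻ as (xs⊆ys (there y∈xs))
  ... | inj₁ y∈as           = ∈-++⁺ˡ y∈as
  ... | inj₂ (here refl)    = contradiction refl (All.lookup x∉ y∈xs)
  ... | inj₂ (there y∈bs)   = ∈-++⁺ʳ as y∈bs

prefix-++ : ∀ {b} (s z : Word b) → HasPrefix s (s ++ z)
prefix-++ []      z = []
prefix-++ (x ∷ s) z = refl ∷ prefix-++ s z

prefix⇒++ : ∀ {b} {s X : Word b} → HasPrefix s X → ∃[ z ] X ≡ s ++ z
prefix⇒++ {X = X} []        = X , refl
prefix⇒++ (_∷_ {a = x} refl pre) with z , eq ← prefix⇒++ pre = z , cong (x ∷_) eq

∈-words : ∀ {b} (z : Word b) → z ∈ words b (length z)
∈-words []      = here refl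
∈-words (d ∷ z) = ∈-cartesianProductWith⁺ _∷_ (∈-allFin d) (∈-words z)

-- Averages over a digit and over uniformly random words.

module _ (b : ℕ) .{{_ : NonTrivial b}} where

  avg : (Fin b → ℚ) → ℚ
  avg φ = inv b * ∑ (allFin b) φ

  avg-cong : ∀ {φ ψ} → (∀ d → φ d ≡ ψ d) → avg φ ≡ avg ψ
  avg-cong φ≗ψ = cong (inv b *_) (∑-cong (allFin b) φ≗ψ)

  avg-+ : ∀ φ ψ → avg (λ d → φ d + ψ d) ≡ avg φ + avg ψ
  avg-+ φ ψ = trans (cong (inv b *_) (∑-+ (allFin b) φ ψ)) (*-distribˡ-+ (inv b) _ _)

  avg-* : ∀ c φ → avg (λ d → c * φ d) ≡ c * avg φ
  avg-* c φ = trans (cong (inv b *_) (∑-* (allFin b) c φ)) (*-swapˡ (inv b) c _)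

  avg-const : ∀ c → avg (λ _ → c) ≡ c
  avg-const c = begin
    inv b * ∑ (allFin b) (λ _ → c)           ≡⟨ cong (inv b *_) (∑-const (allFin b) c) ⟩
    inv b * (fromℕ (length (allFin b)) * c)  ≡⟨ cong (λ m → inv b * (fromℕ m * c)) (length-tabulate {n = b} id) ⟩
    inv b * (fromℕ b * c)                    ≡⟨ trans (*-swapˡ (inv b) (fromℕ b) c) (sym (*-assoc (fromℕ b) (inv b) c)) ⟩
    fromℕ b * inv b * c                      ≡⟨ cong (_* c) (fromℕ*inv b) ⟩
    1ℚ * c                                   ≡⟨ *-identityˡ c ⟩
    c                                        ∎
    where open ≡-Reasoning

  avg-mono : ∀ {φ ψ} → (∀ d → φ d ≤ ψ d) → avg φ ≤ avg ψ
  avg-mono φ≤ψ = *-monoˡ (0≤inv b) (∑-mono (allFin b) φ≤ψ)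

  avg-nonNeg : ∀ {φ} → (∀ d → 0ℚ ≤ φ d) → 0ℚ ≤ avg φ
  avg-nonNeg {φ} 0≤φ = subst (_≤ avg φ) (avg-const 0ℚ) (avg-mono 0≤φ)

  -- A nonnegative term is at most the whole sum, which is `b` averages. This is the price of one
  -- digit in the factor b^|s|.
  point≤avg : ∀ {φ} → (∀ d → 0ℚ ≤ φ d) → ∀ d → φ d ≤ fromℕ b * avg φ
  point≤avg {φ} 0≤φ d = begin
    φ d                               ≤⟨ ∑-∈ 0≤φ (∈-allFin d) ⟩
    ∑ (allFin b) φ                    ≡⟨ *-identityˡ _ ⟨
    1ℚ * ∑ (allFin b) φ               ≡⟨ cong (_* ∑ (allFin b) φ) (fromℕ*inv b) ⟨
    fromℕ b * inv b * ∑ (allFin b) φ  ≡⟨ *-assoc (fromℕ b) (inv b) _ ⟩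
    fromℕ b * avg φ                   ∎
    where open ≤-Reasoning

  𝔼 : ℕ → (Word b → ℚ) → ℚ
  𝔼 n g = inv b ^ n * ∑ (words b n) g

  𝔼-zero : ∀ g → 𝔼 0 g ≡ g []
  𝔼-zero g = trans (*-identityˡ _) (+-identityʳ (g []))

  𝔼-suc : ∀ n g → 𝔼 (suc n) g ≡ avg (λ d → 𝔼 n (λ z → g (d ∷ z)))
  𝔼-suc n g = begin
    inv b * inv b ^ n * ∑ (words b (suc n)) g                                   ≡⟨ *-assoc (inv b) (inv b ^ n) _ ⟩
    inv b * (inv b ^ n * ∑ (words b (suc n)) g)                                 ≡⟨ cong (λ x → inv b * (inv b ^ n * x)) (∑-cartesianProductWith _∷_ (allFin b) (words b n) g) ⟩
    inv b * (inv b ^ n * ∑ (allFin b) (λ d → ∑ (words b n) (λ z → g (d ∷ z))))  ≡⟨ cong (inv b *_) (∑-* (allFin b) (inv b ^ n) _) ⟨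
    avg (λ d → 𝔼 n (λ z → g (d ∷ z)))                                           ∎
    where open ≡-Reasoning

  𝔼-cong : ∀ n {g h} → (∀ z → g z ≡ h z) → 𝔼 n g ≡ 𝔼 n h
  𝔼-cong n g≗h = cong (inv b ^ n *_) (∑-cong (words b n) g≗h)

  𝔼-+ : ∀ n g h → 𝔼 n (λ z → g z + h z) ≡ 𝔼 n g + 𝔼 n h
  𝔼-+ n g h = trans (cong (inv b ^ n *_) (∑-+ (words b n) g h)) (*-distribˡ-+ (inv b ^ n) _ _)

  𝔼-* : ∀ n c g → 𝔼 n (λ z → c * g z) ≡ c * 𝔼 n g
  𝔼-* n c g = trans (cong (inv b ^ n *_) (∑-* (words b n) c g)) (*-swapˡ (inv b ^ n) c _)

  𝔼-mono : ∀ n {g h} → (∀ z → g z ≤ h z) → 𝔼 n g ≤ 𝔼 n h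
  𝔼-mono n g≤h = *-monoˡ (0≤^ (0≤inv b) n) (∑-mono (words b n) g≤h)

  𝔼-const : ∀ n c → 𝔼 n (λ _ → c) ≡ c
  𝔼-const zero    c = 𝔼-zero (λ _ → c)
  𝔼-const (suc n) c = trans (𝔼-suc n (λ _ → c)) (trans (avg-cong (λ _ → 𝔼-const n c)) (avg-const c))

  -- The partial sums of the series: the total of b^(-|z|) g(z) over all words `z` shorter than `M`,
  -- as `∑-shorts` confirms.
  ∑𝔼 : ℕ → (Word b → ℚ) → ℚ
  ∑𝔼 M g = ∑ (upTo M) (λ n → 𝔼 n g)

  -- A word is empty or has a first digit, and that digit is uniform.
  ∑𝔼-suc : ∀ M g → ∑𝔼 (suc M) g ≡ g [] + avg (λ d → ∑𝔼 M (λ z → g (d ∷ z)))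
  ∑𝔼-suc M g = begin
    ∑𝔼 (suc M) g                                                                  ≡⟨ ∑-upTo-∷ M (λ n → 𝔼 n g) ⟩
    𝔼 0 g + ∑ (upTo M) (λ n → 𝔼 (suc n) g)                                        ≡⟨ cong₂ _+_ (𝔼-zero g) (∑-cong (upTo M) (λ n → 𝔼-suc n g)) ⟩
    g [] + ∑ (upTo M) (λ n → avg (λ d → 𝔼 n (λ z → g (d ∷ z))))                   ≡⟨ cong (g [] +_) (∑-* (upTo M) (inv b) _) ⟩
    g [] + inv b * ∑ (upTo M) (λ n → ∑ (allFin b) (λ d → 𝔼 n (λ z → g (d ∷ z))))  ≡⟨ cong (λ x → g [] + inv b * x) (∑-swap (upTo M) (allFin b) _) ⟩
    g [] + avg (λ d → ∑𝔼 M (λ z → g (d ∷ z)))                                     ∎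
    where open ≡-Reasoning

  ∑𝔼-cong : ∀ M {g h} → (∀ z → g z ≡ h z) → ∑𝔼 M g ≡ ∑𝔼 M h
  ∑𝔼-cong M g≗h = ∑-cong (upTo M) (λ n → 𝔼-cong n g≗h)

  ∑𝔼-+ : ∀ M g h → ∑𝔼 M (λ z → g z + h z) ≡ ∑𝔼 M g + ∑𝔼 M h
  ∑𝔼-+ M g h = trans (∑-cong (upTo M) (λ n → 𝔼-+ n g h)) (∑-+ (upTo M) _ _)

  ∑𝔼-mono : ∀ M {g h} → (∀ z → g z ≤ h z) → ∑𝔼 M g ≤ ∑𝔼 M h
  ∑𝔼-mono M g≤h = ∑-mono (upTo M) (λ n → 𝔼-mono n g≤h)

  -- Each digit of `v` is matched with probability 1/b, independently of the remaining `n` digits,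
  -- which stay uniform.
  𝔼-cylinder : ∀ (v : Word b) n (h : Word b → ℚ) →
    𝔼 (length v ℕ.+ n) (λ X → 𝟙 (take (length v) X ≟ʷ v) * h X) ≡
    inv b ^ length v * 𝔼 n (λ z → h (v ++ z))
  𝔼-cylinder [] n h = trans (𝔼-cong n (λ z → *-identityˡ (h z))) (sym (*-identityˡ (𝔼 n h)))
  𝔼-cylinder (x ∷ v) n h = begin
    𝔼 (suc m) (λ X → 𝟙 (take (suc (length v)) X ≟ʷ (x ∷ v)) * h X)
      ≡⟨ 𝔼-suc m (λ X → 𝟙 (take (suc (length v)) X ≟ʷ (x ∷ v)) * h X) ⟩
    avg (λ d → 𝔼 m (λ Y → 𝟙 ((d ∷ take (length v) Y) ≟ʷ (x ∷ v)) * h (d ∷ Y)))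
      ≡⟨ avg-cong step ⟩
    avg (λ d → 𝟙 (d Fin.≟ x) * 𝔼 m (g d))
      ≡⟨ cong (inv b *_) (∑-allFin-𝟙 x (λ d → 𝔼 m (g d))) ⟩
    inv b * 𝔼 m (g x)
      ≡⟨ cong (inv b *_) (𝔼-cylinder v n (λ Y → h (x ∷ Y))) ⟩
    inv b * (inv b ^ length v * 𝔼 n (λ z → h (x ∷ v ++ z)))
      ≡⟨ *-assoc (inv b) (inv b ^ length v) (𝔼 n (λ z → h (x ∷ v ++ z))) ⟨
    inv b ^ suc (length v) * 𝔼 n (λ z → h (x ∷ v ++ z))
      ∎
    where
    open ≡-Reasoning
    m = length v ℕ.+ n
    g : Fin b → Word b → ℚ
    g d Y = 𝟙 (take (length v) Y ≟ʷ v) * h (d ∷ Y)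
    step : ∀ d → 𝔼 m (λ Y → 𝟙 ((d ∷ take (length v) Y) ≟ʷ (x ∷ v)) * h (d ∷ Y)) ≡ 𝟙 (d Fin.≟ x) * 𝔼 m (g d)
    step d = trans
      (𝔼-cong m (λ Y → trans (cong (_* h (d ∷ Y)) (𝟙-∷ d x (take (length v) Y) v))
        (*-assoc (𝟙 (d Fin.≟ x)) (𝟙 (take (length v) Y ≟ʷ v)) (h (d ∷ Y)))))
      (𝔼-* m (𝟙 (d Fin.≟ x)) (g d))

  avg-- : ∀ c φ → avg (λ d → c - φ d) ≡ c - avg φ
  avg-- c φ = begin
    avg (λ d → c - φ d)                  ≡⟨ x+y-y≡x (avg (λ d → c - φ d)) (avg φ) ⟨
    avg (λ d → c - φ d) + avg φ - avg φ  ≡⟨ cong (_- avg φ) (avg-+ (λ d → c - φ d) φ) ⟨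
    avg (λ d → c - φ d + φ d) - avg φ    ≡⟨ cong (_- avg φ) (avg-cong (λ d → solve 2 (λ c x → c :- x :+ x := c) refl c (φ d))) ⟩
    avg (λ d → c) - avg φ                ≡⟨ cong (_- avg φ) (avg-const c) ⟩
    c - avg φ                            ∎
    where
    open ≡-Reasoning
    open +-*-Solver

  𝔼-cong-length : ∀ n {g h : Word b → ℚ} → (∀ z → length z ≡ n → g z ≡ h z) → 𝔼 n g ≡ 𝔼 n h
  𝔼-cong-length zero {g} {h} g≗h = cong (λ x → 1ℚ * (x + 0ℚ)) (g≗h [] refl)
  𝔼-cong-length (suc n) {g} {h} g≗h = trans (𝔼-suc n g) (trans
    (avg-cong (λ d → 𝔼-cong-length n (λ z |z|≡n → g≗h (d ∷ z) (cong suc |z|≡n)))) (sym (𝔼-suc n h)))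

  𝔼-nonNeg : ∀ n {g : Word b → ℚ} → (∀ z → 0ℚ ≤ g z) → 0ℚ ≤ 𝔼 n g
  𝔼-nonNeg n {g} 0≤g = subst (_≤ 𝔼 n g) (𝔼-const n 0ℚ) (𝔼-mono n 0≤g)

  -- Enumeration of the words of bounded length.

  shorts : ℕ → List (Word b)
  shorts zero    = []
  shorts (suc M) = [] ∷ cartesianProductWith _∷_ (allFin b) (shorts M)

  ∈-shorts : ∀ {M} z → length z ℕ.< M → z ∈ shorts M
  ∈-shorts {suc M} []      z<M = here refl
  ∈-shorts {suc M} (d ∷ z) (s≤s z<M) = there (∈-cartesianProductWith⁺ _∷_ (∈-allFin d) (∈-shorts z z<M))

  shorts! : ∀ M → Unique (shorts M)
  shorts! zero    = []
  shorts! (suc M) = All.cartesianProductWith⁺ (setoid (Fin b)) (setoid (Word b)) _∷_ (allFin b) (shorts M) (λ _ _ ())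
    ∷ Unique.cartesianProductWith⁺ _∷_ ∷-injective (Unique.allFin⁺ b) (shorts! M)

  -- `shorts` is built by first digit rather than by length, so that this sum obeys the recursion
  -- `∑𝔼-suc`.
  ∑-shorts : ∀ M g → ∑ (shorts M) (λ z → inv b ^ length z * g z) ≡ ∑𝔼 M g
  ∑-shorts zero    g = refl
  ∑-shorts (suc M) g = begin
    1ℚ * g [] + ∑ (cartesianProductWith _∷_ (allFin b) (shorts M)) f
      ≡⟨ cong₂ _+_ (*-identityˡ (g [])) (∑-cartesianProductWith _∷_ (allFin b) (shorts M) f) ⟩
    g [] + ∑ (allFin b) (λ d → ∑ (shorts M) (λ z → inv b * inv b ^ length z * g (d ∷ z)))
      ≡⟨ cong (g [] +_) (∑-cong (allFin b) (λ d → trans (∑-cong (shorts M) (λ z → *-assoc (inv b) (inv b ^ length z) (g (d ∷ z))))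
           (trans (∑-* (shorts M) (inv b) (λ z → inv b ^ length z * g (d ∷ z))) (cong (inv b *_) (∑-shorts M (λ z → g (d ∷ z))))))) ⟩
    g [] + ∑ (allFin b) (λ d → inv b * ∑𝔼 M (λ z → g (d ∷ z)))
      ≡⟨ cong (g [] +_) (∑-* (allFin b) (inv b) (λ d → ∑𝔼 M (λ z → g (d ∷ z)))) ⟩
    g [] + avg (λ d → ∑𝔼 M (λ z → g (d ∷ z)))
      ≡⟨ ∑𝔼-suc M g ⟨
    ∑𝔼 (suc M) g
      ∎
    where
    open ≡-Reasoning
    f : Word b → ℚ
    f z = inv b ^ length z * g z

  -- Occurrences of a fixed nonempty word.

  module Occurrences (x₀ : Fin b) (w′ : Word b) where

    w : Word b
    w = x₀ ∷ w′

    -- `q` = p - 1 is the context that decides occurrences: one that starts before a block of `q`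
    -- digits ends no later than that block.
    q p : ℕ
    q = length w′
    p = suc q

    occ : Word b → ℕ
    occ = occurrences w

    δ : Word b → ℕ
    δ X = bit (take p X ≟ʷ w)

    -- Index 0 gives `δ`; the index `suc i` in `x ∷ X` is the index `i` in `X`.
    occ-∷ : ∀ x X → occ (x ∷ X) ≡ δ (x ∷ X) ℕ.+ occ X
    occ-∷ x X = trans (length-filter-∷ occursAt? 0 (applyUpTo suc (length X)))
      (cong (δ (x ∷ X) ℕ.+_) (trans (cong (λ is → length (filter occursAt? is)) (sym (map-upTo suc (length X))))
        (length-filter-map occursAt? suc (upTo (length X)))))
      where
      occursAt? : Decidable (λ i → take p (drop i (x ∷ X)) ≡ w)
      occursAt? i = take p (drop i (x ∷ X)) ≟ʷ w

    δ-++ : ∀ X z → p ℕ.≤ length X → δ (X ++ z) ≡ δ X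
    δ-++ X z p≤ = cong (λ Y → bit (Y ≟ʷ w)) (take-++-≤ p X z p≤)

    δ-short : ∀ X → length X ℕ.< p → δ X ≡ 0
    δ-short X X<p = bit-no (take p X ≟ʷ w) λ eq →
      ℕ.<⇒≢ X<p (cong length (trans (sym (take-all p X (ℕ.<⇒≤ X<p))) eq))

    δ-≢ : ∀ X → length X ≡ p → X ≢ w → δ X ≡ 0
    δ-≢ X X≡p X≢w = bit-no (take p X ≟ʷ w) λ eq →
      X≢w (trans (sym (take-all p X (ℕ.≤-reflexive X≡p))) eq)

    δ-w : ∀ z → δ (w ++ z) ≡ 1
    δ-w z = bit-yes (take p (w ++ z) ≟ʷ w) (trans (take-++-≤ p w z ℕ.≤-refl) (take-all p w ℕ.≤-refl))

    occ-short : ∀ X → length X ℕ.≤ q → occ X ≡ 0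
    occ-short []      X≤q = refl
    occ-short (x ∷ X) X≤q = trans (occ-∷ x X)
      (cong₂ ℕ._+_ (δ-short (x ∷ X) (s≤s X≤q)) (occ-short X (ℕ.<⇒≤ X≤q)))

    occ-≤-++ : ∀ s z → occ s ℕ.≤ occ (s ++ z)
    occ-≤-++ []      z = z≤n
    occ-≤-++ (x ∷ s) z rewrite occ-∷ x s | occ-∷ x (s ++ z) = ℕ.+-mono-≤ δ≤ (occ-≤-++ s z)
      where
      δ≤ : δ (x ∷ s) ℕ.≤ δ (x ∷ s ++ z)
      δ≤ with ℕ.≤-<-connex p (suc (length s))
      ... | inj₁ p≤ = ℕ.≤-reflexive (sym (δ-++ (x ∷ s) z p≤))
      ... | inj₂ <p = ℕ.≤-trans (ℕ.≤-reflexive (δ-short (x ∷ s) <p)) z≤n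

    occ-++-≤ : ∀ u z → occ (u ++ z) ℕ.≤ length u ℕ.+ occ z
    occ-++-≤ []      z = ℕ.≤-refl
    occ-++-≤ (x ∷ u) z rewrite occ-∷ x (u ++ z) = ℕ.+-mono-≤ (bit≤1 (take p (x ∷ u ++ z) ≟ʷ w)) (occ-++-≤ u z)

    occ-w-++ : ∀ z → 0 ℕ.< occ (w ++ z)
    occ-w-++ z rewrite occ-∷ x₀ (w′ ++ z) | δ-w z = s≤s z≤n

    -- As `s` has at least `q` digits, an occurrence that starts in `u` ends inside `u ++ s`, so `u`
    -- contributes the same number whatever follows `s`. The additive form avoids truncated
    -- subtraction.
    occ-++-++ : ∀ u s z → q ℕ.≤ length s → occ (u ++ s ++ z) ℕ.+ occ s ≡ occ (u ++ s) ℕ.+ occ (s ++ z)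
    occ-++-++ []      s z q≤ = ℕ.+-comm (occ (s ++ z)) (occ s)
    occ-++-++ (x ∷ u) s z q≤ = begin
      occ (x ∷ u ++ s ++ z) ℕ.+ occ s                      ≡⟨ cong (ℕ._+ occ s) (occ-∷ x (u ++ s ++ z)) ⟩
      δ (x ∷ u ++ s ++ z) ℕ.+ occ (u ++ s ++ z) ℕ.+ occ s  ≡⟨ cong (λ i → i ℕ.+ occ (u ++ s ++ z) ℕ.+ occ s) δ≡ ⟩
      δ (x ∷ u ++ s) ℕ.+ occ (u ++ s ++ z) ℕ.+ occ s       ≡⟨ ℕ.+-assoc (δ (x ∷ u ++ s)) _ _ ⟩
      δ (x ∷ u ++ s) ℕ.+ (occ (u ++ s ++ z) ℕ.+ occ s)     ≡⟨ cong (δ (x ∷ u ++ s) ℕ.+_) (occ-++-++ u s z q≤) ⟩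
      δ (x ∷ u ++ s) ℕ.+ (occ (u ++ s) ℕ.+ occ (s ++ z))   ≡⟨ ℕ.+-assoc (δ (x ∷ u ++ s)) _ _ ⟨
      δ (x ∷ u ++ s) ℕ.+ occ (u ++ s) ℕ.+ occ (s ++ z)     ≡⟨ cong (ℕ._+ occ (s ++ z)) (occ-∷ x (u ++ s)) ⟨
      occ (x ∷ u ++ s) ℕ.+ occ (s ++ z)                    ∎
      where
      open ≡-Reasoning
      p≤ : p ℕ.≤ length (x ∷ u ++ s)
      p≤ = s≤s (ℕ.≤-trans q≤ (ℕ.≤-trans (ℕ.m≤n+m (length s) (length u)) (ℕ.≤-reflexive (sym (length-++ u)))))
      δ≡ : δ (x ∷ u ++ s ++ z) ≡ δ (x ∷ u ++ s)
      δ≡ = trans (cong (λ Y → δ (x ∷ Y)) (sym (++-assoc u s z))) (δ-++ (x ∷ u ++ s) z p≤)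

    -- Telescoping the distribution of the count.

    L : ℚ
    L = fromℕ b ^ p

    0≤L : 0ℚ ≤ L
    0≤L = 0≤^ (0≤fromℕ b) p

    L*inv : L * inv b ^ p ≡ 1ℚ
    L*inv = ^-inverse {fromℕ b} {inv b} (fromℕ*inv b) p

    ℙ≤ : ℕ → ℕ → ℚ
    ℙ≤ n k = 𝔼 n (λ X → 𝟙 (occ X ℕ.≤? k))

    hits : Word b → ℕ → Word b → ℚ
    hits s K z = 𝟙 (occ (s ++ z) ℕ.≟ K)

    starts : ℕ → Word b → ℚ
    starts k X = 𝟙 (take p X ≟ʷ w) * 𝟙 (occ X ℕ.≟ suc k)

    0≤starts : ∀ k X → 0ℚ ≤ starts k X
    0≤starts k X = 0≤* (0≤𝟙 (take p X ≟ʷ w)) (0≤𝟙 (occ X ℕ.≟ suc k))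

    0≤ℙ≤ : ∀ n k → 0ℚ ≤ ℙ≤ n k
    0≤ℙ≤ n k = 𝔼-nonNeg n (λ X → 0≤𝟙 (occ X ℕ.≤? k))

    -- Dropping the first digit of a uniform word of length `suc n` leaves a uniform word of length
    -- `n`; `𝟙-≤-bit` compares the two counts, and `starts k` is the event that is lost.
    ℙ≤-suc : ∀ n k → ℙ≤ n k ≡ ℙ≤ (suc n) k + 𝔼 (suc n) (starts k)
    ℙ≤-suc n k = sym (begin
      ℙ≤ (suc n) k + 𝔼 (suc n) (starts k)              ≡⟨ 𝔼-+ (suc n) (λ X → 𝟙 (occ X ℕ.≤? k)) (starts k) ⟨
      𝔼 (suc n) (λ X → 𝟙 (occ X ℕ.≤? k) + starts k X)  ≡⟨ 𝔼-suc n (λ X → 𝟙 (occ X ℕ.≤? k) + starts k X) ⟩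
      avg (λ d → 𝔼 n (λ Y → 𝟙 (occ (d ∷ Y) ℕ.≤? k) + starts k (d ∷ Y)))
                                                            ≡⟨ avg-cong (λ d → 𝔼-cong n (step d)) ⟩
      avg (λ _ → ℙ≤ n k)  ≡⟨ avg-const (ℙ≤ n k) ⟩
      ℙ≤ n k              ∎)
      where
      open ≡-Reasoning
      step : ∀ d Y → 𝟙 (occ (d ∷ Y) ℕ.≤? k) + starts k (d ∷ Y) ≡ 𝟙 (occ Y ℕ.≤? k)
      step d Y = trans
        (cong (λ m → 𝟙 (m ℕ.≤? k) + 𝟙 (take p (d ∷ Y) ≟ʷ w) * 𝟙 (m ℕ.≟ suc k)) (occ-∷ d Y))
        (sym (𝟙-≤-bit (take p (d ∷ Y) ≟ʷ w) (occ Y) k))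

    ℙ≤-antitone : ∀ n k → ℙ≤ (suc n) k ≤ ℙ≤ n k
    ℙ≤-antitone n k = subst₂ _≤_ (+-identityʳ (ℙ≤ (suc n) k)) (sym (ℙ≤-suc n k))
      (+-monoʳ-≤ (ℙ≤ (suc n) k) (𝔼-nonNeg (suc n) (0≤starts k)))

    ℙ≤-q : ∀ k → ℙ≤ q k ≡ 1ℚ
    ℙ≤-q k = trans
      (𝔼-cong-length q (λ X |X|≡q → 𝟙-yes (occ X ℕ.≤? k)
        (ℕ.≤-trans (ℕ.≤-reflexive (occ-short X (ℕ.≤-reflexive |X|≡q))) z≤n)))
      (𝔼-const q 1ℚ)

    -- By `𝔼-cylinder` the term at `M` is the expectation of `starts k` at length `p + M`, hence the
    -- drop of `ℙ≤` from length `q + M` to `p + M`. The sum starts at length `q`, where `w` does not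
    -- fit and `ℙ≤` is 1.
    telescope : ∀ M k → inv b ^ p * ∑𝔼 M (hits w (suc k)) + ℙ≤ (q ℕ.+ M) k ≡ 1ℚ
    telescope zero k = trans (cong₂ _+_ (*-zeroʳ (inv b ^ p)) (trans (cong (λ n → ℙ≤ n k) (ℕ.+-identityʳ q)) (ℙ≤-q k))) (+-identityˡ 1ℚ)
    telescope (suc M) k = begin
      r * ∑𝔼 (suc M) g + ℙ≤ (q ℕ.+ suc M) k                   ≡⟨ cong₂ (λ x n → r * x + ℙ≤ n k) (∑-upTo-∷ʳ M (λ n → 𝔼 n g)) (ℕ.+-suc q M) ⟩
      r * (∑𝔼 M g + 𝔼 M g) + ℙ≤ (p ℕ.+ M) k                   ≡⟨ solve 4 (λ r x y z → r :* (x :+ y) :+ z := r :* x :+ (z :+ r :* y)) refl r (∑𝔼 M g) (𝔼 M g) (ℙ≤ (p ℕ.+ M) k) ⟩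
      r * ∑𝔼 M g + (ℙ≤ (p ℕ.+ M) k + r * 𝔼 M g)               ≡⟨ cong (λ x → r * ∑𝔼 M g + (ℙ≤ (p ℕ.+ M) k + x)) (𝔼-cylinder w M (λ X → 𝟙 (occ X ℕ.≟ suc k))) ⟨
      r * ∑𝔼 M g + (ℙ≤ (p ℕ.+ M) k + 𝔼 (p ℕ.+ M) (starts k))  ≡⟨ cong (r * ∑𝔼 M g +_) (ℙ≤-suc (q ℕ.+ M) k) ⟨
      r * ∑𝔼 M g + ℙ≤ (q ℕ.+ M) k                             ≡⟨ telescope M k ⟩
      1ℚ                                                      ∎
      where
      open ≡-Reasoning
      open +-*-Solver
      g = hits w (suc k)
      r = inv b ^ p

    -- Deficits, and the decay of `ℙ≤`.

    deficit : ℕ → Word b → ℕ → ℚ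
    deficit M s K = L - ∑𝔼 M (hits s K)

    deficit-w : ∀ M k → deficit M w (suc k) ≡ L * ℙ≤ (q ℕ.+ M) k
    deficit-w M k = begin
      L - x                           ≡⟨ cong (λ y → L - y) (trans (sym (*-identityˡ x)) (cong (_* x) (sym L*inv))) ⟩
      -- Adding and subtracting `L * a` exposes the left side of `telescope`.
      L - L * r * x                   ≡⟨ solve 4 (λ l r x a → l :- l :* r :* x := l :* (con 1ℚ :- (r :* x :+ a)) :+ l :* a) refl L r x a ⟩
      L * (1ℚ - (r * x + a)) + L * a  ≡⟨ cong (λ y → L * (1ℚ - y) + L * a) (telescope M k) ⟩
      L * 0ℚ + L * a                  ≡⟨ cong (_+ L * a) (*-zeroʳ L) ⟩
      0ℚ + L * a                      ≡⟨ +-identityˡ (L * a) ⟩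
      L * a                           ∎
      where
      open ≡-Reasoning
      open +-*-Solver
      x = ∑𝔼 M (hits w (suc k))
      r = inv b ^ p
      a = ℙ≤ (q ℕ.+ M) k

    0≤deficit-w : ∀ M k → 0ℚ ≤ deficit M w (suc k)
    0≤deficit-w M k = subst (0ℚ ≤_) (sym (deficit-w M k)) (0≤* 0≤L (0≤ℙ≤ (q ℕ.+ M) k))

    ∑𝔼-w≤L : ∀ M k → ∑𝔼 M (hits w (suc k)) ≤ L
    ∑𝔼-w≤L M k = subst (_≤ L) (solve 2 (λ l x → l :- (l :- x) := x) refl L (∑𝔼 M (hits w (suc k)))) (x-y≤x (0≤deficit-w M k))
      where open +-*-Solver

    -- Every word `w ++ z` has a positive count, and each of the counts 1 to `K` contributes at most
    -- `L`, uniformly in `M`.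
    ∑𝔼-w-≤ : ∀ M K → ∑𝔼 M (λ z → 𝟙 (occ (w ++ z) ℕ.≤? K)) ≤ fromℕ K * L
    ∑𝔼-w-≤ M zero = ≤-reflexive (begin
      ∑𝔼 M (λ z → 𝟙 (occ (w ++ z) ℕ.≤? 0))  ≡⟨ ∑𝔼-cong M (λ z → 𝟙-no (occ (w ++ z) ℕ.≤? 0) (ℕ.<⇒≱ (occ-w-++ z))) ⟩
      ∑𝔼 M (λ _ → 0ℚ)                       ≡⟨ ∑-cong (upTo M) (λ n → 𝔼-const n 0ℚ) ⟩
      ∑ (upTo M) (λ _ → 0ℚ)                 ≡⟨ ∑-0 (upTo M) ⟩
      0ℚ                                    ≡⟨ *-zeroˡ L ⟨
      0ℚ * L                                ∎)
      where open ≡-Reasoning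
    ∑𝔼-w-≤ M (suc K) = begin
      ∑𝔼 M (λ z → 𝟙 (occ (w ++ z) ℕ.≤? suc K))                      ≡⟨ ∑𝔼-cong M (λ z → 𝟙-≤-suc (occ (w ++ z)) K) ⟩
      ∑𝔼 M (λ z → 𝟙 (occ (w ++ z) ℕ.≤? K) + hits w (suc K) z)       ≡⟨ ∑𝔼-+ M (λ z → 𝟙 (occ (w ++ z) ℕ.≤? K)) (hits w (suc K)) ⟩
      ∑𝔼 M (λ z → 𝟙 (occ (w ++ z) ℕ.≤? K)) + ∑𝔼 M (hits w (suc K))  ≤⟨ +-mono-≤ (∑𝔼-w-≤ M K) (∑𝔼-w≤L M K) ⟩
      fromℕ K * L + L                                               ≡⟨ solve 2 (λ k l → k :* l :+ l := (con 1ℚ :+ k) :* l) refl (fromℕ K) L ⟩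
      (1ℚ + fromℕ K) * L                                            ≡⟨ cong (_* L) (fromℕ-suc K) ⟨
      fromℕ (suc K) * L                                             ∎
      where
      open ≤-Reasoning
      open +-*-Solver

    -- The terms decrease with the length, so each of the first `M` is at least `ℙ≤ M k`.
    ℙ≤-∑𝔼 : ∀ M k → fromℕ M * ℙ≤ M k ≤ ∑𝔼 M (λ X → 𝟙 (occ X ℕ.≤? k))
    ℙ≤-∑𝔼 zero    k = ≤-reflexive (*-zeroˡ (ℙ≤ 0 k))
    ℙ≤-∑𝔼 (suc M) k = begin
      fromℕ (suc M) * ℙ≤ (suc M) k            ≤⟨ *-monoˡ (0≤fromℕ (suc M)) (ℙ≤-antitone M k) ⟩
      fromℕ (suc M) * ℙ≤ M k                  ≡⟨ cong (_* ℙ≤ M k) (fromℕ-suc M) ⟩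
      (1ℚ + fromℕ M) * ℙ≤ M k                 ≡⟨ solve 2 (λ m a → (con 1ℚ :+ m) :* a := m :* a :+ a) refl (fromℕ M) (ℙ≤ M k) ⟩
      fromℕ M * ℙ≤ M k + ℙ≤ M k               ≤⟨ +-monoˡ-≤ (ℙ≤ M k) (ℙ≤-∑𝔼 M k) ⟩
      ∑𝔼 M (λ X → 𝟙 (occ X ℕ.≤? k)) + ℙ≤ M k  ≡⟨ ∑-upTo-∷ʳ M (λ n → ℙ≤ n k) ⟨
      ∑𝔼 (suc M) (λ X → 𝟙 (occ X ℕ.≤? k))     ∎
      where
      open ≤-Reasoning
      open +-*-Solver

    -- Putting `w` in front of `z` creates at most `p` new occurrences, which brings the sum under
    -- `∑𝔼-w-≤`.
    ℙ≤-decay : ∀ M k → fromℕ M * ℙ≤ M k ≤ fromℕ (p ℕ.+ k) * L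
    ℙ≤-decay M k = begin
      fromℕ M * ℙ≤ M k                                    ≤⟨ ℙ≤-∑𝔼 M k ⟩
      ∑𝔼 M (λ X → 𝟙 (occ X ℕ.≤? k))                     ≤⟨ ∑𝔼-mono M (λ z → 𝟙-mono (occ z ℕ.≤? k) (occ (w ++ z) ℕ.≤? p ℕ.+ k)
                                                              (λ occ≤k → ℕ.≤-trans (occ-++-≤ w z) (ℕ.+-monoʳ-≤ p occ≤k))) ⟩
      ∑𝔼 M (λ z → 𝟙 (occ (w ++ z) ℕ.≤? p ℕ.+ k))  ≤⟨ ∑𝔼-w-≤ M (p ℕ.+ k) ⟩
      fromℕ (p ℕ.+ k) * L                         ∎
      where open ≤-Reasoning

    -- With fewer than `K` occurrences in `s`, the empty continuation is no hit, so all hits pass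
    -- through some `s ∷ʳ d` and have one digit less to choose.
    deficit-suc : ∀ M s K → occ s ℕ.< K → deficit (suc M) s K ≡ avg (λ d → deficit M (s ∷ʳ d) K)
    deficit-suc M s K s<K = sym (trans (avg-- L (λ d → ∑𝔼 M (hits (s ∷ʳ d) K))) (cong (λ x → L - x) (sym (begin
      ∑𝔼 (suc M) (hits s K)                                           ≡⟨ ∑𝔼-suc M (hits s K) ⟩
      hits s K [] + avg (λ d → ∑𝔼 M (λ z → hits s K (d ∷ z)))       ≡⟨ cong₂ _+_
                                                                            (𝟙-no (occ (s ++ []) ℕ.≟ K) (λ eq → ℕ.<⇒≢ s<K (trans (cong occ (sym (++-identityʳ s))) eq)))
                                                                            (avg-cong (λ d → ∑𝔼-cong M (λ z → cong (λ X → 𝟙 (occ X ℕ.≟ K)) (sym (++-assoc s (d ∷ []) z))))) ⟩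
      0ℚ + avg (λ d → ∑𝔼 M (hits (s ∷ʳ d) K))  ≡⟨ +-identityˡ (avg (λ d → ∑𝔼 M (hits (s ∷ʳ d) K))) ⟩
      avg (λ d → ∑𝔼 M (hits (s ∷ʳ d) K))       ∎))))
      where open ≡-Reasoning

    -- By `occ-++-++`, `u` changes the count by the same amount for every continuation of `s`.
    -- Writing the target as a count plus `j` moves it along without subtraction; it is measured at
    -- `s`, so that `t` may hold digits read later.
    deficit-shift : ∀ M u s t j → q ℕ.≤ length s →
                    deficit M (u ++ s ++ t) (occ (u ++ s) ℕ.+ j) ≡ deficit M (s ++ t) (occ s ℕ.+ j)
    deficit-shift M u s t j q≤ = cong (λ x → L - x) (∑𝔼-cong M λ z →
      𝟙-⇔ (occ ((u ++ s ++ t) ++ z) ℕ.≟ occ (u ++ s) ℕ.+ j) (occ ((s ++ t) ++ z) ℕ.≟ occ s ℕ.+ j)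
        (λ eq → ℕ.+-cancelˡ-≡ (occ (u ++ s)) _ _ (begin
          occ (u ++ s) ℕ.+ occ ((s ++ t) ++ z)  ≡⟨ split z ⟨
          occ ((u ++ s ++ t) ++ z) ℕ.+ occ s    ≡⟨ cong (ℕ._+ occ s) eq ⟩
          occ (u ++ s) ℕ.+ j ℕ.+ occ s          ≡⟨ ℕ.+-assoc (occ (u ++ s)) j (occ s) ⟩
          occ (u ++ s) ℕ.+ (j ℕ.+ occ s)        ≡⟨ cong (occ (u ++ s) ℕ.+_) (ℕ.+-comm j (occ s)) ⟩
          occ (u ++ s) ℕ.+ (occ s ℕ.+ j)        ∎))
        (λ eq → ℕ.+-cancelʳ-≡ (occ s) _ _ (begin
          occ ((u ++ s ++ t) ++ z) ℕ.+ occ s    ≡⟨ split z ⟩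
          occ (u ++ s) ℕ.+ occ ((s ++ t) ++ z)  ≡⟨ cong (occ (u ++ s) ℕ.+_) eq ⟩
          occ (u ++ s) ℕ.+ (occ s ℕ.+ j)        ≡⟨ cong (occ (u ++ s) ℕ.+_) (ℕ.+-comm (occ s) j) ⟩
          occ (u ++ s) ℕ.+ (j ℕ.+ occ s)        ≡⟨ ℕ.+-assoc (occ (u ++ s)) j (occ s) ⟨
          occ (u ++ s) ℕ.+ j ℕ.+ occ s          ∎)))
      where
      open ≡-Reasoning
      split : ∀ z → occ ((u ++ s ++ t) ++ z) ℕ.+ occ s ≡ occ (u ++ s) ℕ.+ occ ((s ++ t) ++ z)
      split z = begin
        occ ((u ++ s ++ t) ++ z) ℕ.+ occ s    ≡⟨ cong (λ X → occ X ℕ.+ occ s) (trans (++-assoc u (s ++ t) z) (cong (u ++_) (++-assoc s t z))) ⟩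
        occ (u ++ s ++ t ++ z) ℕ.+ occ s      ≡⟨ occ-++-++ u s (t ++ z) q≤ ⟩
        occ (u ++ s) ℕ.+ occ (s ++ t ++ z)    ≡⟨ cong (λ X → occ (u ++ s) ℕ.+ occ X) (++-assoc s t z) ⟨
        occ (u ++ s) ℕ.+ occ ((s ++ t) ++ z)  ∎

    -- Bounds on deficits.

    deficit≤L : ∀ M s K → deficit M s K ≤ L
    deficit≤L M s K = x-y≤x (∑-nonNeg (upTo M) (λ n → 𝔼-nonNeg n (λ z → 0≤𝟙 (occ (s ++ z) ℕ.≟ K))))

    -- Mutual induction that lowers `M` at each added digit. After `deficit-suc`, leading digits are
    -- shifted away until `p` digits remain; these are either `w`, where the telescoped formula
    -- applies, or lead back to a word of length `q`.
    0≤deficit : ∀ M s K → q ℕ.≤ length s → occ s ℕ.< K → 0ℚ ≤ deficit M s K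
    -- The count is bounded at `s` and not at `s ∷ʳ d`, because `d` may complete an occurrence of
    -- `w` and bring the count up to `K`.
    0≤deficit-∷ʳ : ∀ M s K d → q ℕ.≤ length s → occ s ℕ.< K → 0ℚ ≤ deficit M (s ∷ʳ d) K
    -- A word of length `p` other than `w` contains no `w`, and neither does its tail, so dropping
    -- the first digit keeps the target.
    0≤deficit-p : ∀ M y K → length y ≡ p → 0 ℕ.< K → 0ℚ ≤ deficit M y K

    0≤deficit zero    s K q≤ s<K = 0≤- 0≤L
    0≤deficit (suc M) s K q≤ s<K = subst (0ℚ ≤_) (sym (deficit-suc M s K s<K))
      (avg-nonNeg (λ d → 0≤deficit-∷ʳ M s K d q≤ s<K))

    0≤deficit-p M y@(x ∷ v) (suc k) |y|≡p 0<K with y ≟ʷ w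
    ... | yes refl = 0≤deficit-w M k
    ... | no y≢w = subst (0ℚ ≤_) (sym eq) (0≤deficit M v (suc k) q≤ (subst (ℕ._< suc k) (sym occv≡0) (s≤s z≤n)))
      where
      |v|≡q : length v ≡ q
      |v|≡q = ℕ.suc-injective |y|≡p
      q≤ : q ℕ.≤ length v
      q≤ = ℕ.≤-reflexive (sym |v|≡q)
      occv≡0 : occ v ≡ 0
      occv≡0 = occ-short v (ℕ.≤-reflexive |v|≡q)
      eq : deficit M (x ∷ v) (suc k) ≡ deficit M v (suc k)
      eq = begin
        deficit M (x ∷ v) (suc k)                        ≡⟨ cong₂ (deficit M) (cong (x ∷_) (++-identityʳ v)) (cong (ℕ._+ suc k) (trans (occ-∷ x v) (cong₂ ℕ._+_ (δ-≢ y |y|≡p y≢w) occv≡0))) ⟨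
        deficit M (x ∷ v ++ []) (occ (x ∷ v) ℕ.+ suc k)  ≡⟨ deficit-shift M (x ∷ []) v [] (suc k) q≤ ⟩
        deficit M (v ++ []) (occ v ℕ.+ suc k)            ≡⟨ cong₂ (deficit M) (++-identityʳ v) (cong (ℕ._+ suc k) occv≡0) ⟩
        deficit M v (suc k)                              ∎
        where open ≡-Reasoning

    0≤deficit-∷ʳ M s K d q≤ s<K with ℕ.m≤n⇒m<n∨m≡n q≤
    ... | inj₂ q≡ = 0≤deficit-p M (s ∷ʳ d) K (trans (length-++ s) (trans (ℕ.+-comm (length s) 1) (cong suc (sym q≡)))) (ℕ.≤-<-trans z≤n s<K)
    0≤deficit-∷ʳ M (x ∷ s) K d q≤ s<K | inj₁ (s≤s q≤s) =
      -- `K` is rewritten as `occ (x ∷ s) + j` to fit `deficit-shift`. Here `j` is positive, so `s`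
      -- still has fewer occurrences than its new target `occ s + j`.
      subst (λ K → 0ℚ ≤ deficit M (x ∷ s ∷ʳ d) K) (ℕ.m+[n∸m]≡n (ℕ.<⇒≤ s<K))
        (subst (0ℚ ≤_) (sym (deficit-shift M (x ∷ []) s (d ∷ []) j q≤s))
          (0≤deficit-∷ʳ M s (occ s ℕ.+ j) d q≤s (ℕ.m<m+n (occ s) (ℕ.m<n⇒0<n∸m s<K))))
      where
      j = K ℕ.∸ occ (x ∷ s)

    -- One digit costs a factor `b` by `point≤avg`, whose nonnegative siblings come from
    -- `0≤deficit-∷ʳ`, and one unit of `M` by `deficit-suc`. Counts only grow along `v`, so the
    -- bound at `s ++ v` covers every intermediate word.
    deficit-++ : ∀ M s v K → q ℕ.≤ length s → occ (s ++ v) ℕ.< K →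
                 deficit M (s ++ v) K ≤ fromℕ b ^ length v * deficit (length v ℕ.+ M) s K
    deficit-++ M s [] K q≤ <K = ≤-reflexive (trans (cong (λ X → deficit M X K) (++-identityʳ s)) (sym (*-identityˡ (deficit M s K))))
    deficit-++ M s (d ∷ v) K q≤ <K = begin
      deficit M (s ++ d ∷ v) K                                        ≡⟨ cong (λ X → deficit M X K) eq ⟨
      deficit M ((s ∷ʳ d) ++ v) K                                     ≤⟨ deficit-++ M (s ∷ʳ d) v K
                                                                           (ℕ.≤-trans q≤ (ℕ.≤-trans (ℕ.m≤m+n (length s) 1) (ℕ.≤-reflexive (sym (length-++ s)))))
                                                                           (subst (λ X → occ X ℕ.< K) (sym eq) <K) ⟩
      β ^ length v * deficit m (s ∷ʳ d) K                    ≤⟨ *-monoˡ (0≤^ (0≤fromℕ b) (length v)) (point≤avg (λ d → 0≤deficit-∷ʳ m s K d q≤ s<K) d) ⟩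
      β ^ length v * (β * avg (λ d → deficit m (s ∷ʳ d) K))  ≡⟨ cong (λ x → β ^ length v * (β * x)) (deficit-suc m s K s<K) ⟨
      β ^ length v * (β * deficit (suc m) s K)               ≡⟨ *-swapˡ (β ^ length v) β (deficit (suc m) s K) ⟩
      β * (β ^ length v * deficit (suc m) s K)               ≡⟨ *-assoc β (β ^ length v) (deficit (suc m) s K) ⟨
      β ^ suc (length v) * deficit (suc m) s K               ∎
      where
      open ≤-Reasoning
      β = fromℕ b
      m = length v ℕ.+ M
      eq : (s ∷ʳ d) ++ v ≡ s ++ d ∷ v
      eq = ++-assoc s (d ∷ []) v
      s<K : occ s ℕ.< K
      s<K = ℕ.≤-<-trans (occ-≤-++ s (d ∷ v)) <K

    -- Nonnegativity keeps all partial sums below `L`; the O(1/M) bound makes them converge to it.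
    -- The constant may depend on `s` and `K`.
    Controlled : Word b → ℕ → Set
    Controlled s K = (∀ M → 0ℚ ≤ deficit M s K) × ∃[ C ] (∀ M → fromℕ M * deficit M s K ≤ C)

    controlled-≥q : ∀ s K → q ℕ.≤ length s → occ s ℕ.< K → Controlled s K
    controlled-≥q s K q≤ s<K = (λ M → 0≤deficit M s K q≤ s<K) , β ^ l * (L * (fromℕ (p ℕ.+ k) * L)) , bound
      where
      open +-*-Solver
      β = fromℕ b
      l = length s
      -- The predecessor puts the target at `w ++ s` in the form `suc k` that `deficit-w` requires.
      j′ = ℕ.pred (K ℕ.∸ occ s)
      k = occ (w ++ s) ℕ.+ j′
      K≡ : K ≡ occ s ℕ.+ suc j′
      K≡ = trans (sym (ℕ.m+[n∸m]≡n (ℕ.<⇒≤ s<K)))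
        (cong (occ s ℕ.+_) (sym (ℕ.suc-pred (K ℕ.∸ occ s) {{ℕ.>-nonZero (ℕ.m<n⇒0<n∸m s<K)}})))
      deficit≤ : ∀ M → deficit M s K ≤ β ^ l * (L * ℙ≤ (q ℕ.+ (l ℕ.+ M)) k)
      deficit≤ M = begin
        deficit M s K                                       ≡⟨ cong₂ (deficit M) (sym (++-identityʳ s)) K≡ ⟩
        deficit M (s ++ []) (occ s ℕ.+ suc j′)              ≡⟨ deficit-shift M w s [] (suc j′) q≤ ⟨
        deficit M (w ++ s ++ []) (occ (w ++ s) ℕ.+ suc j′)  ≡⟨ cong₂ (λ X m → deficit M (w ++ X) m) (++-identityʳ s) (ℕ.+-suc (occ (w ++ s)) j′) ⟩
        deficit M (w ++ s) (suc k)                          ≤⟨ deficit-++ M w s (suc k) (ℕ.n≤1+n q) (s≤s (ℕ.m≤m+n (occ (w ++ s)) j′)) ⟩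
        β ^ l * deficit (l ℕ.+ M) w (suc k)                 ≡⟨ cong (β ^ l *_) (deficit-w (l ℕ.+ M) k) ⟩
        β ^ l * (L * ℙ≤ (q ℕ.+ (l ℕ.+ M)) k)                ∎
        where open ≤-Reasoning
      bound : ∀ M → fromℕ M * deficit M s K ≤ β ^ l * (L * (fromℕ (p ℕ.+ k) * L))
      bound M = begin
        fromℕ M * deficit M s K              ≤⟨ *-monoˡ (0≤fromℕ M) (deficit≤ M) ⟩
        fromℕ M * (β ^ l * (L * ℙ≤ m k))     ≡⟨ solve 4 (λ m x l a → m :* (x :* (l :* a)) := x :* (l :* (m :* a))) refl (fromℕ M) (β ^ l) L (ℙ≤ m k) ⟩
        -- `ℙ≤` is taken at the length `m ≥ M`, so the factor `M` is raised to `m` to match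
        -- `ℙ≤-decay`.
        β ^ l * (L * (fromℕ M * ℙ≤ m k))     ≤⟨ *-monoˡ 0≤βˡ (*-monoˡ 0≤L (*-monoʳ (0≤ℙ≤ m k) (fromℕ-mono M≤m))) ⟩
        β ^ l * (L * (fromℕ m * ℙ≤ m k))     ≤⟨ *-monoˡ 0≤βˡ (*-monoˡ 0≤L (ℙ≤-decay m k)) ⟩
        β ^ l * (L * (fromℕ (p ℕ.+ k) * L))  ∎
        where
        open ≤-Reasoning
        m = q ℕ.+ (l ℕ.+ M)
        M≤m : M ℕ.≤ m
        M≤m = ℕ.≤-trans (ℕ.m≤n+m M l) (ℕ.m≤n+m (l ℕ.+ M) q)
        0≤βˡ : 0ℚ ≤ β ^ l
        0≤βˡ = 0≤^ (0≤fromℕ b) l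

    -- Serves words shorter than `q`, which are too short for `deficit-shift`: both bounds pass
    -- through the average of `deficit-suc`.
    controlled-avg : ∀ s K → occ s ℕ.< K → (∀ d → Controlled (s ∷ʳ d) K) → Controlled s K
    -- The summand `L` pays for the one extra copy of the averaged deficit in `suc M` = 1 + `M`.
    controlled-avg s K s<K ctrl = nonNeg , avg C + L , bound
      where
      C : Fin b → ℚ
      C d = proj₁ (proj₂ (ctrl d))
      nonNeg : ∀ M → 0ℚ ≤ deficit M s K
      nonNeg zero    = 0≤- 0≤L
      nonNeg (suc M) = subst (0ℚ ≤_) (sym (deficit-suc M s K s<K)) (avg-nonNeg (λ d → proj₁ (ctrl d) M))
      0≤C : ∀ d → 0ℚ ≤ C d
      -- The bound for `d` at `M` = 0 reads 0 ≤ `C d`.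
      0≤C d = subst (_≤ C d) (*-zeroˡ (deficit 0 (s ∷ʳ d) K)) (proj₂ (proj₂ (ctrl d)) 0)
      bound : ∀ M → fromℕ M * deficit M s K ≤ avg C + L
      bound zero    = subst₂ _≤_ (sym (*-zeroˡ (deficit 0 s K))) refl (+-mono-≤ (avg-nonNeg 0≤C) 0≤L)
      bound (suc M) = begin
        fromℕ (suc M) * deficit (suc M) s K                       ≡⟨ cong₂ _*_ (fromℕ-suc M) (deficit-suc M s K s<K) ⟩
        (1ℚ + fromℕ M) * D                                        ≡⟨ solve 2 (λ m d → (con 1ℚ :+ m) :* d := m :* d :+ d) refl (fromℕ M) D ⟩
        fromℕ M * D + D                                           ≡⟨ cong (_+ D) (avg-* (fromℕ M) (λ d → deficit M (s ∷ʳ d) K)) ⟨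
        avg (λ d → fromℕ M * deficit M (s ∷ʳ d) K) + D          ≤⟨ +-mono-≤ (avg-mono (λ d → proj₂ (proj₂ (ctrl d)) M))
                                                                       (≤-trans (avg-mono (λ d → deficit≤L M (s ∷ʳ d) K)) (≤-reflexive (avg-const L))) ⟩
        avg C + L                                               ∎
        where
        open ≤-Reasoning
        open +-*-Solver
        D = avg (λ d → deficit M (s ∷ʳ d) K)

    -- Induction on n, which bounds the number of digits s lacks to have length q.
    controlled : ∀ n s K → q ℕ.≤ n ℕ.+ length s → occ s ℕ.< K → Controlled s K
    controlled zero    s K q≤ s<K = controlled-≥q s K q≤ s<K
    controlled (suc n) s K q≤ s<K with ℕ.≤-<-connex q (length s)
    ... | inj₁ q≤s = controlled-≥q s K q≤s s<K
    ... | inj₂ s<q = controlled-avg s K s<K λ d → controlled n (s ∷ʳ d) K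
      (ℕ.≤-trans q≤ (ℕ.≤-reflexive (trans (sym (ℕ.+-suc n (length s))) (cong (n ℕ.+_) (sym (|s∷ʳd| d))))))
      (ℕ.≤-<-trans (ℕ.≤-reflexive (occ-short (s ∷ʳ d) (ℕ.≤-trans (ℕ.≤-reflexive (|s∷ʳd| d)) s<q))) (ℕ.≤-<-trans z≤n s<K))
      where
      |s∷ʳd| : ∀ d → length (s ∷ʳ d) ≡ suc (length s)
      |s∷ʳd| d = trans (length-++ s) (ℕ.+-comm (length s) 1)

    -- From bounds on deficits to convergence.

    weight : Word b → ℚ
    weight X = inv b ^ length X

    0≤weight : ∀ X → 0ℚ ≤ weight X
    0≤weight X = 0≤^ (0≤inv b) (length X)

    -- The finite sets that exhaust the summation: a large one serves as `F₀`, and every admissible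
    -- finite set lies in a still larger one.
    extensions : Word b → ℕ → ℕ → List (Word b)
    extensions s k M = map (s ++_) (filter (λ z → occ (s ++ z) ℕ.≟ k) (shorts M))

    ∑-extensions : ∀ s k M → ∑ (extensions s k M) weight ≡ weight s * ∑𝔼 M (hits s k)
    ∑-extensions s k M = begin
      ∑ (extensions s k M) weight                                 ≡⟨ ∑-map (s ++_) (filter (λ z → occ (s ++ z) ℕ.≟ k) (shorts M)) weight ⟩
      ∑ (filter (λ z → occ (s ++ z) ℕ.≟ k) (shorts M)) (λ z → weight (s ++ z))
                                                                  ≡⟨ ∑-filter (λ z → occ (s ++ z) ℕ.≟ k) (shorts M) (λ z → weight (s ++ z)) ⟩
      ∑ (shorts M) (λ z → hits s k z * weight (s ++ z))        ≡⟨ ∑-cong (shorts M) step ⟩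
      ∑ (shorts M) (λ z → weight s * (weight z * hits s k z))  ≡⟨ ∑-* (shorts M) (weight s) (λ z → weight z * hits s k z) ⟩
      weight s * ∑ (shorts M) (λ z → weight z * hits s k z)    ≡⟨ cong (weight s *_) (∑-shorts M (hits s k)) ⟩
      weight s * ∑𝔼 M (hits s k)                               ∎
      where
      open ≡-Reasoning
      open +-*-Solver
      step : ∀ z → hits s k z * weight (s ++ z) ≡ weight s * (weight z * hits s k z)
      step z = trans (cong (hits s k z *_) (trans (cong (inv b ^_) (length-++ s)) (^-+ (inv b) (length s) (length z))))
        (solve 3 (λ h x y → h :* (x :* y) := x :* (y :* h)) refl (hits s k z) (weight s) (weight z))

    -- `P` is a parameter so that the sum over all admissible words is the instance `s = []`,
    -- without a prefix condition in its predicate.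
    sumOver : ∀ {P : Word b → Set} s k → occ s ℕ.< k →
              (∀ {X} → P X → Admissible w k X × HasPrefix s X) →
              (∀ {X} → Admissible w k X × HasPrefix s X → P X) →
              SumOver P weight (L * weight s)
    sumOver {P} s k s<k to from ε 0<ε = extensions s k M , F₀! , F₀-P , close
      where
      ctrl : Controlled s k
      ctrl = controlled q s k (ℕ.m≤m+n q (length s)) s<k
      small : ∃[ n₀ ] (∀ n → n₀ ℕ.≤ n → weight s * deficit n s k < ε)
      small = O[1/n]⇒small {u = λ n → weight s * deficit n s k} {C = weight s * proj₁ (proj₂ ctrl)}
        (λ n → ≤-trans (≤-reflexive (*-swapˡ (fromℕ n) (weight s) (deficit n s k))) (*-monoˡ (0≤weight s) (proj₂ (proj₂ ctrl) n)))
        ε 0<ε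
      M = proj₁ small
      F₀! : Unique (extensions s k M)
      F₀! = Unique.map⁺ (++-cancelˡ s _ _) (Unique.filter⁺ (λ z → occ (s ++ z) ℕ.≟ k) (shorts! M))
      F₀-P : All P (extensions s k M)
      F₀-P = All.map⁺ (All.map (λ {z} adm → from (adm , prefix-++ s z)) (All.all-filter (λ z → occ (s ++ z) ℕ.≟ k) (shorts M)))
      L-∑ : ∀ M → L * weight s - ∑ (extensions s k M) weight ≡ weight s * deficit M s k
      L-∑ M = trans (cong (λ x → L * weight s - x) (∑-extensions s k M))
        (solve 3 (λ l x g → l :* x :- x :* g := x :* (l :- g)) refl L (weight s) (∑𝔼 M (hits s k)))
        where open +-*-Solver
      close : ∀ F → Unique F → All P F → extensions s k M ⊆ F → ∣ ∑ F weight - L * weight s ∣ < ε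
      close F F! F-P F₀⊆F = begin-strict
        ∣ ∑ F weight - L * weight s ∣               ≡⟨ ∣x-y∣≡y-x (∑ F weight) (L * weight s) 0≤L-∑F ⟩
        -- `F` contains the extensions up to `M`, so it falls short by no more than they do.
        L * weight s - ∑ F weight                   ≤⟨ +-monoʳ-≤ (L * weight s) (neg-antimono-≤ (∑-⊆ F₀! F₀⊆F 0≤weight)) ⟩
        L * weight s - ∑ (extensions s k M) weight  ≡⟨ L-∑ M ⟩
        weight s * deficit M s k                    <⟨ proj₂ small M ℕ.≤-refl ⟩
        ε                                           ∎
        where
        open ≤-Reasoning
        -- Larger than the length of every word in `F`, so `F` lies among the extensions up to `M′`,
        -- and their nonnegative deficit keeps the sum over `F` from exceeding the limit.
        M′ = suc (max 0 (map length F))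
        F⊆ : F ⊆ extensions s k M′
        F⊆ {X} X∈F with adm , pre ← to (All.lookup F-P X∈F) with z , refl ← prefix⇒++ pre =
          ∈-map⁺ (s ++_) (∈-filter⁺ (λ z → occ (s ++ z) ℕ.≟ k) (∈-shorts z z<M′) adm)
          where
          z<M′ : length z ℕ.< M′
          z<M′ = s≤s (ℕ.≤-trans (ℕ.m≤n+m (length z) (length s)) (ℕ.≤-trans (ℕ.≤-reflexive (sym (length-++ s)))
            (All.lookup (xs≤max 0 (map length F)) (∈-map⁺ length X∈F))))
        0≤L-∑F : 0ℚ ≤ L * weight s - ∑ F weight
        0≤L-∑F = ≤-trans (subst (0ℚ ≤_) (sym (L-∑ M′)) (0≤* (0≤weight s) (proj₁ ctrl M′)))
          (+-monoʳ-≤ (L * weight s) (neg-antimono-≤ (∑-⊆ F! F⊆ 0≤weight)))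

    -- For empty `s`, `∑𝔼` is the partial sum of the power series at 1/b, so the distance to `L` is
    -- a deficit.
    Z-value : ∀ k → 1 ℕ.≤ k → Z w k At inv b HasValue L
    Z-value k 1≤k ε 0<ε = proj₁ small , λ n n₀≤n → begin-strict
      ∣ ∑ (upTo n) (λ l → fromℕ (N w k l) * inv b ^ l) - L ∣  ≡⟨ cong (λ x → ∣ x - L ∣) (∑-cong (upTo n) term) ⟩
      ∣ ∑𝔼 n (hits [] k) - L ∣                                ≡⟨ ∣x-y∣≡y-x (∑𝔼 n (hits [] k)) L (proj₁ ctrl n) ⟩
      deficit n [] k                                          <⟨ proj₂ small n n₀≤n ⟩
      ε                                                       ∎
      where
      open ≤-Reasoning
      ctrl : Controlled [] k
      ctrl = controlled q [] k (ℕ.m≤m+n q 0) 1≤k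
      small : ∃[ n₀ ] (∀ n → n₀ ℕ.≤ n → deficit n [] k < ε)
      small = O[1/n]⇒small (proj₂ (proj₂ ctrl)) ε 0<ε
      term : ∀ l → fromℕ (N w k l) * inv b ^ l ≡ 𝔼 l (hits [] k)
      term l = trans (*-comm (fromℕ (N w k l)) (inv b ^ l))
        (cong (inv b ^ l *_) (fromℕ-length-filter (λ X → occ X ℕ.≟ k) (words b l)))

    -- The tail `w′` has length p - 1, hence is one of the words in the maximum, and appending it
    -- loses no occurrence.
    occ≤k* : ∀ s → occ s ℕ.≤ k* w s
    occ≤k* s = ℕ.≤-trans (occ-≤-++ s w′) (All.lookup (xs≤max 0 _) (∈-map⁺ (λ z → occ (s ++ z)) (∈-words w′)))

theorem3 : ∀ (b : ℕ) .{{_ : NonTrivial b}} (w : Word b) → 1 ℕ.≤ length w →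
    (∀ (s : Word b) (k : ℕ) → suc (k* w s) ℕ.≤ k →
    SumOver (λ X → Admissible w k X × HasPrefix s X)
    (λ X → inv b ^ length X)
    (fromℕ b ^ length w * inv b ^ length s))
    × (∀ (k : ℕ) → 1 ℕ.≤ k →
    (Z w k At inv b HasValue (fromℕ b ^ length w))
    × SumOver (Admissible w k) (λ X → inv b ^ length X) (fromℕ b ^ length w))
theorem3 b w@(x₀ ∷ w′) _ =
  (λ s k k*<k → sumOver s k (ℕ.≤-<-trans (occ≤k* s) k*<k) id id) ,
  (λ k 1≤k → Z-value k 1≤k ,
    -- The empty prefix has weight 1, which is removed from the limit.
    subst (SumOver (Admissible w k) weight) (*-identityʳ L) (sumOver [] k 1≤k (λ adm → adm , []) proj₁))
  where
  open Occurrences b x₀ w′ using (L; weight; sumOver; Z-value; occ≤k*)
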